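{- A lattice simplex $\Delta$ is (isomorphic to) a free join $\Delta_1\circ_{\mathbb{Z}}\Delta_2$ of lattice simplices $\Delta_1$ and $\Delta_2$ if and only if the corresponding linear code $C_\Delta$ is (isomorphic to) the direct sum $C_{\Delta_1}\oplus C_{\Delta_2}$.
   Context: Let $M\cong\mathbb{Z}^d$ be a lattice and $\Delta$ a $d$-dimensional lattice simplex in $M\otimes\mathbb{R}$ with vertices $v_0,\dots,v_d\in M$. Lattice simplices are isomorphic if an affine unimodular transformation maps one to the other. The free join of lattice polytopes $\Delta_1,\Delta_2$ of dimensions $d_1,d_2$ is $\Delta_1\circ_{\mathbb{Z}}\Delta_2=\operatorname{conv}(\Delta_1\times\{0^{d_2}\}\times\{0\},\ \{0^{d_1}\}\times\Delta_2\times\{1\})\subset\mathbb{R}^{d_1+d_2+1}$. Code of a simplex: $\mathbb{Z}_N=\mathbb{Z}/N\mathbb{Z}$. Let $\Lambda_\Delta=\{x\in(\mathbb{R}/\mathbb{Z})^{d+1}:\sum_i\{x_i\}(v_i,1)\in M\oplus\mathbb{Z}\}$, where $\{\cdot\}$ is the fractional part. $N_\Delta$ is the least common multiple of the denominators of all coordinates of elements of $\Lambda_\Delta$, and $C_\Delta=\{(N_\Delta\{x_0\},\dots,N_\Delta\{x_d\}):x\in\Lambda_\Delta\}\subseteq\mathbb{Z}_{N_\Delta}^{d+1}$. Codes over the same $\mathbb{Z}_N$ and of the same length are isomorphic if they coincide after a permutation of coordinates. It is known that two lattice simplices are isomorphic if and only if their codes are. Direct sum: for codes $C_1$ over $\mathbb{Z}_{N_1}$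 and $C_2$ over $\mathbb{Z}_{N_2}$, with $L=\operatorname{lcm}(N_1,N_2)$, $C_1\oplus C_2$ is the code over $\mathbb{Z}_L$ consisting of all concatenations $\frac{L}{N_1}c_1\,|\,\frac{L}{N_2}c_2$, $c_1\in C_1$, $c_2\in C_2$. -}

module Defs where

open import Data.Bool.Base using (if_then_else_)
open import Data.Fin.Base using (Fin; zero; suc; toℕ; fromℕ<; cast; _↑ˡ_; _↑ʳ_)
open import Data.Fin.Permutation using (Permutation; _⟨$⟩ˡ_)
open import Data.Fin.Properties using (¬∀⟶∃¬; all?; toℕ-fromℕ<) renaming (_≟_ to _≟ᶠ_)
open import Data.Integer.Base as ℤ using (ℤ; +_; -[1+_]; 0ℤ; 1ℤ)
import Data.Integer.DivMod as ℤ
import Data.Integer.Properties as ℤ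
open import Data.Nat.Base as ℕ using (ℕ; zero; suc; NonZero)
open import Data.Nat.Coprimality as Coprime using ()
open import Data.Nat.Divisibility using (_∣_; ∣-refl; ∣-trans; 1∣_)
open import Data.Nat.DivMod using (_mod_)
open import Data.Nat.GCD using (gcd)
open import Data.Nat.LCM using (lcm; gcd*lcm; m∣lcm[m,n]; n∣lcm[m,n]; lcm-least)
import Data.Nat.Properties as ℕ
open import Data.Product.Base using (Σ; ∃-syntax; _×_; _,_; proj₁; proj₂)
open import Data.Rational.Base
  using (ℚ; mkℚ; 0ℚ; 1ℚ; _+_; _*_; _-_; -_; 1/_; _/_; _≤_; _<_; *≤*; *<*; ↥_; ↧_; ↧ₙ_; floor; ≢-nonZero)
  renaming (NonZero to NonZeroℚ)
open import Data.Rational.Properties as ℚ using (_≟_; +-*-commutativeRing)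
open import Data.Rational.Solver using (module +-*-Solver)
open import Data.Vec.Base as Vec using (Vec)
import Data.Vec.Properties as Vec
open import Data.Vec.Functional using (Vector; []; _∷_; _++_; map; replicate)
open import Data.Vec.Functional.Properties using (lookup-++ˡ; lookup-++ʳ)
open import Algebra.Bundles using (CommutativeRing)
import Algebra.Properties.Semiring.Sum as Sum
open import Function.Base using (_∘_; it)
open import Function.Bundles using (_⇔_)
open import Level using (0ℓ)
open import Relation.Binary.PropositionalEquality
open import Relation.Nullary using (¬_; Dec; yes; no; contradiction; does)
open import Relation.Unary using (Pred; _∈_; _∪_)

open Sum (CommutativeRing.semiring +-*-commutativeRing) public
  using (sum; sum-syntax; sum-cong-≗; ∑-distrib-+; *-distribˡ-sum; *-distribʳ-sum; sum-replicate-zero)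
module ℤΣ = Sum (CommutativeRing.semiring ℤ.+-*-commutativeRing)

private
  variable
    d d₁ d₂ k m n N₁ N₂ : ℕ

ι : ℤ → ℚ
ι z = z / 1

IsInteger : Pred ℚ 0ℓ
IsInteger q = ∃[ z ] q ≡ ι z

-- Data.Rational.fracPart is ∣ p - truncate p ∣, which is not {p} for p < 0.
frac : ℚ → ℚ
frac p = p - ι (floor p)

record LatticeSimplex (d : ℕ) : Set where
  field
    vertex            : Vector (Vector ℤ d) (suc d)
    affineIndependent : ∀ (c : Vector ℚ (suc d)) →
                        ∑[ i < suc d ] c i ≡ 0ℚ →
                        (∀ j → ∑[ i < suc d ] (c i * ι (vertex i j)) ≡ 0ℚ) →
                        ∀ i → c i ≡ 0ℚ

open LatticeSimplex public

-- Rational points stand for real ones: a lattice polytope is determined by its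
-- rational points, and these are the rational convex combinations of its vertices.
PointSet : ℕ → Set₁
PointSet n = Pred (Vector ℚ n) 0ℓ

conv : PointSet n → PointSet n
conv {n} S p = ∃[ k ] Σ (Vector (Vector ℚ n) k) λ q → Σ (Vector ℚ k) λ c →
  (∀ a → q a ∈ S) × (∀ a → 0ℚ ≤ c a) × ∑[ a < k ] c a ≡ 1ℚ ×
  (∀ j → p j ≡ ∑[ a < k ] (c a * q a j))

points : LatticeSimplex d → PointSet d
points Δ = conv (λ p → ∃[ i ] p ≗ map ι (vertex Δ i))

infixr 6 _∘ℤ_
_∘ℤ_ : PointSet d₁ → PointSet d₂ → PointSet (d₁ ℕ.+ (d₂ ℕ.+ 1))
_∘ℤ_ {d₁} {d₂} P Q = conv (bottom ∪ top)
  where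
  bottom top : PointSet (d₁ ℕ.+ (d₂ ℕ.+ 1))
  bottom r = ∃[ p ] p ∈ P × r ≗ p ++ (replicate d₂ 0ℚ ++ (0ℚ ∷ []))
  top    r = ∃[ q ] q ∈ Q × r ≗ replicate d₁ 0ℚ ++ (q ++ (1ℚ ∷ []))

Matrix : Set → ℕ → ℕ → Set
Matrix A m n = Fin m → Fin n → A

identity : Matrix ℤ n n
identity i j = if does (i ≟ᶠ j) then 1ℤ else 0ℤ

infixl 7 _⊗_
_⊗_ : Matrix ℤ m n → Matrix ℤ n k → Matrix ℤ m k
(A ⊗ B) i l = ℤΣ.sum (λ j → A i j ℤ.* B j l)

-- x ↦ A x + b with A invertible over ℤ, i.e. an affine isomorphism ℤᵐ ≅ ℤⁿ.
-- Inhabited only for m ≡ n, where A ranges over GLₙ(ℤ).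
record AffineUnimodular (m n : ℕ) : Set where
  field
    A        : Matrix ℤ n m
    A⁻¹      : Matrix ℤ m n
    inverseˡ : ∀ i j → (A⁻¹ ⊗ A) i j ≡ identity i j
    inverseʳ : ∀ i j → (A ⊗ A⁻¹) i j ≡ identity i j
    b        : Vector ℤ n

  apply : Vector ℚ m → Vector ℚ n
  apply p i = ∑[ j < m ] (ι (A i j) * p j) + ι (b i)

open AffineUnimodular public using (apply)

infix 4 _≅_
_≅_ : PointSet m → PointSet n → Set
_≅_ {m} {n} P Q = Σ (AffineUnimodular m n) λ T →
  ∀ q → q ∈ Q ⇔ (∃[ p ] p ∈ P × q ≗ apply T p)

lift : Vector ℤ d → Vector ℤ (d ℕ.+ 1)
lift v = v ++ (1ℤ ∷ [])

-- A vector of rationals x stands for its class in (ℚ/ℤ)ᵈ⁺¹ ⊆ (ℝ/ℤ)ᵈ⁺¹, and x is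
-- only ever used through the fractional parts of its entries. By affine
-- independence the real solutions of the condition are all rational.
Λ : LatticeSimplex d → Pred (Vector ℚ (suc d)) 0ℓ
Λ {d} Δ x = ∀ j → IsInteger (∑[ i < suc d ] (frac (x i) * ι (lift (vertex Δ i) j)))

Denominator : LatticeSimplex d → Pred ℕ 0ℓ
Denominator Δ k = ∃[ x ] x ∈ Λ Δ × ∃[ i ] k ≡ ↧ₙ (frac (x i))

record IsLCM (S : Pred ℕ 0ℓ) (l : ℕ) : Set where
  field
    commonMultiple : ∀ {k} → k ∈ S → k ∣ l
    least          : ∀ {m} → (∀ {k} → k ∈ S → k ∣ m) → l ∣ m

-- From here to denominatorLCM: Λ is killed by some K ≢ 0, hence finite modulo ℤᵈ⁺¹,
-- so the least common multiple of the denominators exists.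

ι≡mkℚ : ∀ z → ι z ≡ mkℚ z 0 (Coprime.sym (Coprime.1-coprimeTo ℤ.∣ z ∣))
ι≡mkℚ z = ℚ.↥p/↧p≡p (mkℚ z 0 (Coprime.sym (Coprime.1-coprimeTo ℤ.∣ z ∣)))

ι-+ : ∀ a b → ι (a ℤ.+ b) ≡ ι a + ι b
ι-+ a b = sym (trans (cong₂ _+_ (ι≡mkℚ a) (ι≡mkℚ b))
  (cong (_/ 1) (cong₂ ℤ._+_ (ℤ.*-identityʳ a) (ℤ.*-identityʳ b))))

ι-* : ∀ a b → ι (a ℤ.* b) ≡ ι a * ι b
ι-* a b = sym (cong₂ _*_ (ι≡mkℚ a) (ι≡mkℚ b))

ι-neg : ∀ a → ι (ℤ.- a) ≡ - ι a
ι-neg a = begin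
  ι (ℤ.- a)              ≡⟨ cong ι (ℤ.-1*i≡-i a) ⟨
  ι (-[1+ 0 ] ℤ.* a)     ≡⟨ ι-* -[1+ 0 ] a ⟩
  (- 1ℚ) * ι a           ≡⟨ solve 1 (λ x → (:- con 1ℚ) :* x := :- x) refl (ι a) ⟩
  - ι a                  ∎
  where open ≡-Reasoning
        open +-*-Solver

ι-cancel-< : ∀ {a b} → ι a < ι b → a ℤ.< b
ι-cancel-< {a} {b} p with subst₂ _<_ (ι≡mkℚ a) (ι≡mkℚ b) p
... | *<* q = subst₂ ℤ._<_ (ℤ.*-identityʳ a) (ℤ.*-identityʳ b) q

ι-cancel-≤ : ∀ {a b} → ι a ≤ ι b → a ℤ.≤ b
ι-cancel-≤ {a} {b} p with subst₂ _≤_ (ι≡mkℚ a) (ι≡mkℚ b) p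
... | *≤* q = subst₂ ℤ._≤_ (ℤ.*-identityʳ a) (ℤ.*-identityʳ b) q

floor-≤ : ∀ p → ι (floor p) ≤ p
floor-≤ p@record{} = subst (_≤ p) (sym (ι≡mkℚ (floor p)))
  (*≤* (subst (floor p ℤ.* ↧ p ℤ.≤_) (sym (ℤ.*-identityʳ (↥ p))) (ℤ.[n/d]*d≤n (↥ p) (↧ p))))

<-floor : ∀ p → p < ι (1ℤ ℤ.+ floor p)
<-floor p@record{} = subst (p <_) (sym (ι≡mkℚ (1ℤ ℤ.+ floor p)))
  (*<* (subst₂ ℤ._<_ (sym (ℤ.*-identityʳ (↥ p)))
    (cong (λ z → (1ℤ ℤ.+ z) ℤ.* ↧ p) (sym (ℤ.div-pos-is-/ℕ (↥ p) (↧ₙ p))))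
    (ℤ.n<s[n/ℕd]*d (↥ p) (↧ₙ p))))

frac-≥0 : ∀ p → 0ℚ ≤ frac p
frac-≥0 p = subst (_≤ frac p) (ℚ.+-inverseʳ (ι (floor p)))
  (ℚ.+-monoˡ-≤ (- ι (floor p)) (floor-≤ p))

frac-<1 : ∀ p → frac p < 1ℚ
frac-<1 p = subst (frac p <_) eq (ℚ.+-monoˡ-< (- ι (floor p)) (<-floor p))
  where
  open +-*-Solver
  eq : ι (1ℤ ℤ.+ floor p) - ι (floor p) ≡ 1ℚ
  eq = trans (cong (_- ι (floor p)) (ι-+ 1ℤ (floor p)))
             (solve 1 (λ x → con 1ℚ :+ x :- x := con 1ℚ) refl (ι (floor p)))

ι-injective : ∀ {a b} → ι a ≡ ι b → a ≡ b
ι-injective {a} {b} eq = cong ↥_ (trans (sym (ι≡mkℚ a)) (trans eq (ι≡mkℚ b)))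

floor≡0 : ∀ {q} → 0ℚ ≤ q → q < 1ℚ → floor q ≡ 0ℤ
floor≡0 {q} 0≤q q<1 = ℤ.≤-antisym
  (ℤ.i<j⇒i≤pred[j] (ι-cancel-< {floor q} {1ℤ} (ℚ.≤-<-trans (floor-≤ q) q<1)))
  (subst (0ℤ ℤ.≤_) (ℤ.pred-suc (floor q))
    (ℤ.i<j⇒i≤pred[j] (ι-cancel-< {0ℤ} {1ℤ ℤ.+ floor q} (ℚ.≤-<-trans 0≤q (<-floor q)))))

frac-id : ∀ {q} → 0ℚ ≤ q → q < 1ℚ → frac q ≡ q
frac-id {q} 0≤q q<1 = trans (cong (λ z → q - ι z) (floor≡0 0≤q q<1)) (ℚ.+-identityʳ q)

frac-idem : ∀ p → frac (frac p) ≡ frac p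
frac-idem p = frac-id (frac-≥0 p) (frac-<1 p)

isInteger? : ∀ q → Dec (IsInteger q)
isInteger? q with ↧ₙ q ℕ.≟ 1
... | yes ↧q≡1 = yes (↥ q , trans (sym (ℚ.↥p/↧p≡p q)) (ℚ./-cong {↥ q} {↧ₙ q} {↥ q} {1} refl ↧q≡1))
... | no  ↧q≢1 = no λ (z , q≡z) → ↧q≢1 (cong ↧ₙ_ (trans q≡z (ι≡mkℚ z)))

int-+ : ∀ {p q} → IsInteger p → IsInteger q → IsInteger (p + q)
int-+ (a , refl) (b , refl) = a ℤ.+ b , sym (ι-+ a b)

int-* : ∀ {p q} → IsInteger p → IsInteger q → IsInteger (p * q)
int-* (a , refl) (b , refl) = a ℤ.* b , sym (ι-* a b)

int-neg : ∀ {p} → IsInteger p → IsInteger (- p)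
int-neg (a , refl) = ℤ.- a , sym (ι-neg a)

int-sum : (f : Vector ℚ n) → (∀ i → IsInteger (f i)) → IsInteger (sum f)
int-sum {zero}  f h = 0ℤ , refl
int-sum {suc n} f h = int-+ (h zero) (int-sum (f ∘ suc) (h ∘ suc))

*-cancel-zeroˡ : ∀ a b → a ≢ 0ℚ → a * b ≡ 0ℚ → b ≡ 0ℚ
*-cancel-zeroˡ a b a≢0 ab≡0 = begin
  b                  ≡⟨ ℚ.*-identityˡ b ⟨
  1ℚ * b             ≡⟨ cong (_* b) (ℚ.*-inverseˡ a) ⟨
  1/ a * a * b       ≡⟨ ℚ.*-assoc (1/ a) a b ⟩
  1/ a * (a * b)     ≡⟨ cong (1/ a *_) ab≡0 ⟩
  1/ a * 0ℚ          ≡⟨ ℚ.*-zeroʳ (1/ a) ⟩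
  0ℚ                 ∎
  where open ≡-Reasoning
        instance _ = ≢-nonZero a≢0

LinearlyIndependent : Vector (Vector ℚ n) k → Set
LinearlyIndependent {n} {k} w =
  ∀ (c : Vector ℚ k) → (∀ j → ∑[ i < k ] (c i * w i j) ≡ 0ℚ) → ∀ i → c i ≡ 0ℚ

-- Fraction-free elimination: row i becomes p wᵢ - wᵢⱼ₀ w₀, with pivot p = w₀ⱼ₀.
clearDenominators : ∀ k {n} (w : Vector (Vector ℚ n) k) → (∀ i j → IsInteger (w i j)) →
  LinearlyIndependent w →
  ∃[ K ] K ≢ 0ℚ × IsInteger K ×
    (∀ (x : Vector ℚ k) → (∀ j → IsInteger (∑[ i < k ] (x i * w i j))) → ∀ i → IsInteger (K * x i))
clearDenominators zero w w∈ℤ ind = 1ℚ , (λ ()) , (1ℤ , refl) , λ _ _ ()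
clearDenominators (suc k) {n} w w∈ℤ ind = K′ * p , K≢0 , int-* K′∈ℤ p∈ℤ , clears
  where
  open ≡-Reasoning
  open +-*-Solver

  w₀≢0 : ¬ (∀ j → w zero j ≡ 0ℚ)
  w₀≢0 w₀≡0 = contradiction (ind e e·w≡0 zero) λ ()
    where
    e : Vector ℚ (suc k)
    e = 1ℚ ∷ replicate k 0ℚ
    e·w≡0 : ∀ j → ∑[ i < suc k ] (e i * w i j) ≡ 0ℚ
    e·w≡0 j = begin
      1ℚ * w zero j + ∑[ i < k ] (0ℚ * w (suc i) j)
        ≡⟨ cong₂ _+_ (cong (1ℚ *_) (w₀≡0 j)) (sum-cong-≗ (λ i → ℚ.*-zeroˡ (w (suc i) j))) ⟩
      1ℚ * 0ℚ + ∑[ i < k ] 0ℚ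
        ≡⟨ cong (_+_ (1ℚ * 0ℚ)) (sum-replicate-zero k) ⟩
      0ℚ ∎

  pivot : ∃[ j ] w zero j ≢ 0ℚ
  pivot = ¬∀⟶∃¬ n (λ j → w zero j ≡ 0ℚ) (λ j → w zero j ≟ 0ℚ) w₀≢0

  j₀ : Fin n
  j₀ = proj₁ pivot

  p : ℚ
  p = w zero j₀

  p∈ℤ : IsInteger p
  p∈ℤ = w∈ℤ zero j₀

  w′ : Vector (Vector ℚ n) k
  w′ i j = p * w (suc i) j - w (suc i) j₀ * w zero j

  w′∈ℤ : ∀ i j → IsInteger (w′ i j)
  w′∈ℤ i j = int-+ (int-* p∈ℤ (w∈ℤ (suc i) j)) (int-neg (int-* (w∈ℤ (suc i) j₀) (w∈ℤ zero j)))

  expand : ∀ (c : Vector ℚ k) j →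
    ∑[ i < k ] (c i * w′ i j) ≡
      p * ∑[ i < k ] (c i * w (suc i) j) - ∑[ i < k ] (c i * w (suc i) j₀) * w zero j
  expand c j = begin
    ∑[ i < k ] (c i * w′ i j)
      ≡⟨ sum-cong-≗ (λ i → solve 5 (λ c p a b w → c :* (p :* a :- b :* w) := p :* (c :* a) :+ (c :* b) :* (:- w)) refl
           (c i) p (w (suc i) j) (w (suc i) j₀) (w zero j)) ⟩
    ∑[ i < k ] (p * (c i * w (suc i) j) + (c i * w (suc i) j₀) * (- w zero j))
      ≡⟨ ∑-distrib-+ (λ i → p * (c i * w (suc i) j)) (λ i → (c i * w (suc i) j₀) * (- w zero j)) ⟩
    ∑[ i < k ] (p * (c i * w (suc i) j)) + ∑[ i < k ] ((c i * w (suc i) j₀) * (- w zero j))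
      ≡⟨ cong₂ _+_ (*-distribˡ-sum p (λ i → c i * w (suc i) j))
                   (*-distribʳ-sum (- w zero j) (λ i → c i * w (suc i) j₀)) ⟨
    p * s + s₀ * (- w zero j)
      ≡⟨ cong (_+_ (p * s)) (sym (ℚ.neg-distribʳ-* s₀ (w zero j))) ⟩
    p * s - s₀ * w zero j ∎
    where
    s s₀ : ℚ
    s  = ∑[ i < k ] (c i * w (suc i) j)
    s₀ = ∑[ i < k ] (c i * w (suc i) j₀)

  ind′ : LinearlyIndependent w′
  ind′ c c·w′≡0 i = *-cancel-zeroˡ p (c i) (proj₂ pivot) (ind c̃ c̃·w≡0 (suc i))
    where
    s₀ : ℚ
    s₀ = ∑[ i < k ] (c i * w (suc i) j₀)
    c̃ : Vector ℚ (suc k)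
    c̃ = (- s₀) ∷ λ i → p * c i
    c̃·w≡0 : ∀ j → ∑[ i < suc k ] (c̃ i * w i j) ≡ 0ℚ
    c̃·w≡0 j = begin
      - s₀ * w zero j + ∑[ i < k ] (p * c i * w (suc i) j)
        ≡⟨ cong (_+_ (- s₀ * w zero j)) (sum-cong-≗ (λ i → ℚ.*-assoc p (c i) (w (suc i) j))) ⟩
      - s₀ * w zero j + ∑[ i < k ] (p * (c i * w (suc i) j))
        ≡⟨ cong (_+_ (- s₀ * w zero j)) (*-distribˡ-sum p (λ i → c i * w (suc i) j)) ⟨
      - s₀ * w zero j + p * s
        ≡⟨ solve 4 (λ s₀ w p s → (:- s₀) :* w :+ p :* s := p :* s :- s₀ :* w) refl s₀ (w zero j) p s ⟩
      p * s - s₀ * w zero j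
        ≡⟨ expand c j ⟨
      ∑[ i < k ] (c i * w′ i j)
        ≡⟨ c·w′≡0 j ⟩
      0ℚ ∎
      where
      s : ℚ
      s = ∑[ i < k ] (c i * w (suc i) j)

  rec = clearDenominators k w′ w′∈ℤ ind′
  K′ = proj₁ rec
  K′∈ℤ = proj₁ (proj₂ (proj₂ rec))

  K≢0 : K′ * p ≢ 0ℚ
  K≢0 K′p≡0 = proj₂ pivot (*-cancel-zeroˡ K′ p (proj₁ (proj₂ rec)) K′p≡0)

  clears : ∀ (x : Vector ℚ (suc k)) → (∀ j → IsInteger (∑[ i < suc k ] (x i * w i j))) →
           ∀ i → IsInteger (K′ * p * x i)
  clears x x·w∈ℤ = λ where
      zero    → subst IsInteger eq₀
                  (int-+ (int-* K′∈ℤ (x·w∈ℤ j₀))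
                         (int-neg (int-sum (λ i → K′ * x (suc i) * w (suc i) j₀)
                           (λ i → int-* (K′x i) (w∈ℤ (suc i) j₀)))))
      (suc i) → subst IsInteger
                  (solve 3 (λ K p x → p :* (K :* x) := K :* p :* x) refl K′ p (x (suc i)))
                  (int-* p∈ℤ (K′x i))
    where
    x′ : Vector ℚ k
    x′ i = x (suc i)
    t : Fin n → ℚ
    t j = ∑[ i < k ] (x′ i * w (suc i) j)
    x′·w′∈ℤ : ∀ j → IsInteger (∑[ i < k ] (x′ i * w′ i j))
    x′·w′∈ℤ j = subst IsInteger
      (trans (solve 5 (λ p x₀ w₀ t t₀ → p :* (x₀ :* w₀ :+ t) :+ (:- ((x₀ :* p :+ t₀) :* w₀)) := p :* t :- t₀ :* w₀) refl
               p (x zero) (w zero j) (t j) (t j₀))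
             (sym (expand x′ j)))
      (int-+ (int-* p∈ℤ (x·w∈ℤ j)) (int-neg (int-* (x·w∈ℤ j₀) (w∈ℤ zero j))))
    K′x : ∀ i → IsInteger (K′ * x (suc i))
    K′x = proj₂ (proj₂ (proj₂ rec)) x′ x′·w′∈ℤ
    eq₀ : K′ * (x zero * p + t j₀) - ∑[ i < k ] (K′ * x (suc i) * w (suc i) j₀) ≡ K′ * p * x zero
    eq₀ = begin
      K′ * (x zero * p + t j₀) - ∑[ i < k ] (K′ * x (suc i) * w (suc i) j₀)
        ≡⟨ cong (λ s → K′ * (x zero * p + t j₀) - s)
             (trans (sum-cong-≗ (λ i → ℚ.*-assoc K′ (x (suc i)) (w (suc i) j₀)))
                    (sym (*-distribˡ-sum K′ (λ i → x (suc i) * w (suc i) j₀)))) ⟩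
      K′ * (x zero * p + t j₀) - K′ * t j₀
        ≡⟨ solve 4 (λ K x p t → K :* (x :* p :+ t) :- K :* t := K :* p :* x) refl K′ (x zero) p (t j₀) ⟩
      K′ * p * x zero ∎

lcm-nonZero : .{{_ : NonZero m}} .{{_ : NonZero n}} → NonZero (lcm m n)
lcm-nonZero {m} {n} = ℕ.≢-nonZero λ lcm≡0 →
  ℕ.≢-nonZero⁻¹ (m ℕ.* n) {{ℕ.m*n≢0 m n}}
    (trans (sym (gcd*lcm m n)) (trans (cong (gcd m n ℕ.*_) lcm≡0) (ℕ.*-zeroʳ (gcd m n))))

FamilyLCM : {I : Set} → (I → ℕ) → Set
FamilyLCM {I} f = ∃[ l ] NonZero l × (∀ i → f i ∣ l) × (∀ {m} → (∀ i → f i ∣ m) → l ∣ m)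

finLCM : ∀ n (f : Fin n → ℕ) → (∀ i → NonZero (f i)) → FamilyLCM f
finLCM zero    f nz = 1 , _ , (λ ()) , λ _ → 1∣ _
finLCM (suc n) f nz with l , l≢0 , mul , lst ← finLCM n (f ∘ suc) (nz ∘ suc) =
  lcm (f zero) l , lcm-nonZero {{nz zero}} {{l≢0}} ,
  (λ where zero    → m∣lcm[m,n] (f zero) l
           (suc i) → ∣-trans (mul i) (n∣lcm[m,n] (f zero) l)) ,
  λ h → lcm-least (h zero) (lst (h ∘ suc))

vecLCM : ∀ n (f : Vec (Fin k) n → ℕ) → (∀ v → NonZero (f v)) → FamilyLCM f
vecLCM zero f nz = f Vec.[] , nz Vec.[] , (λ where Vec.[] → ∣-refl) , λ h → h Vec.[]
vecLCM {k} (suc n) f nz = proj₁ heads , proj₁ (proj₂ heads) ,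
  (λ where (a Vec.∷ v) → ∣-trans (proj₁ (proj₂ (proj₂ (tails a))) v) (proj₁ (proj₂ (proj₂ heads)) a)) ,
  λ h → proj₂ (proj₂ (proj₂ heads)) (λ a → proj₂ (proj₂ (proj₂ (tails a))) (λ v → h (a Vec.∷ v)))
  where
  tails : ∀ a → FamilyLCM (λ v → f (a Vec.∷ v))
  tails a = vecLCM n (λ v → f (a Vec.∷ v)) (λ v → nz (a Vec.∷ v))
  heads : FamilyLCM (λ a → proj₁ (tails a))
  heads = finLCM k _ (λ a → proj₁ (proj₂ (tails a)))

Λ? : (Δ : LatticeSimplex d) → ∀ x → Dec (x ∈ Λ Δ)
Λ? Δ x = all? (λ j → isInteger? _)

Λ-cong : (Δ : LatticeSimplex d) → ∀ x y → (∀ i → frac (x i) ≡ frac (y i)) → x ∈ Λ Δ → y ∈ Λ Δ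
Λ-cong Δ x y x≈y x∈Λ j =
  subst IsInteger (sum-cong-≗ (λ i → cong (_* ι (lift (vertex Δ i) j)) (x≈y i))) (x∈Λ j)

lift-independent : (Δ : LatticeSimplex d) → LinearlyIndependent (λ i j → ι (lift (vertex Δ i) j))
lift-independent {d} Δ c c·w≡0 = affineIndependent Δ c
  (trans (sum-cong-≗ (λ i → sym (trans
    (cong (λ z → c i * ι z) (lookup-++ʳ (vertex Δ i) (1ℤ ∷ []) zero)) (ℚ.*-identityʳ (c i)))))
    (c·w≡0 (d ↑ʳ zero)))
  (λ j → trans (sum-cong-≗ (λ i → cong (λ z → c i * ι z)
    (sym (lookup-++ˡ (vertex Δ i) (1ℤ ∷ []) j))))
    (c·w≡0 (j ↑ˡ 1)))

Λ-exponent : (Δ : LatticeSimplex d) → ∃[ K ] NonZero K ×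
  (∀ x → x ∈ Λ Δ → ∀ i → IsInteger (ι (+ K) * frac (x i)))
Λ-exponent {d} Δ = go (clearDenominators (suc d) w (λ i j → lift (vertex Δ i) j , refl) (lift-independent Δ))
  where
  w : Vector (Vector ℚ (d ℕ.+ 1)) (suc d)
  w i j = ι (lift (vertex Δ i) j)
  go : (∃[ K ] K ≢ 0ℚ × IsInteger K × (∀ x → (∀ j → IsInteger (∑[ i < suc d ] (x i * w i j))) →
         ∀ i → IsInteger (K * x i))) →
       ∃[ K ] NonZero K × (∀ x → x ∈ Λ Δ → ∀ i → IsInteger (ι (+ K) * frac (x i)))
  go (_ , K≢0 , (+ zero   , refl) , clears) = contradiction refl K≢0
  go (_ , K≢0 , (+ suc K  , refl) , clears) = suc K , _ , λ x x∈Λ → clears (λ i → frac (x i)) x∈Λ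
  go (_ , K≢0 , (-[1+ K ] , refl) , clears) = suc K , _ , λ x x∈Λ i → subst IsInteger
    (trans (ℚ.neg-distribˡ-* (ι -[1+ K ]) (frac (x i)))
           (cong (_* frac (x i)) (sym (ι-neg -[1+ K ]))))
    (int-neg (clears (λ i → frac (x i)) x∈Λ i))

lcmFromExponent : (Δ : LatticeSimplex d) (K : ℕ) → NonZero K →
  (∀ x → x ∈ Λ Δ → ∀ i → IsInteger (ι (+ K) * frac (x i))) →
  ∃[ l ] NonZero l × IsLCM (Denominator Δ) l
lcmFromExponent {d} Δ K K≢0 clears = l , l≢0 , record { commonMultiple = common ; least = least′ }
  where
  open ≡-Reasoning
  instance
    _ = K≢0
    ιK≢0 : NonZeroℚ (ι (+ K))
    ιK≢0 = ≢-nonZero λ ιK≡0 → ℕ.≢-nonZero⁻¹ K (ℤ.+-injective (ι-injective ιK≡0))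

  grid : Vec (Fin K) (suc d) → Vector ℚ (suc d)
  grid v i = 1/ ι (+ K) * ι (+ toℕ (Vec.lookup v i))

  denoms : ∀ (x : Vector ℚ (suc d)) → FamilyLCM (λ i → ↧ₙ (frac (x i)))
  denoms x = finLCM (suc d) (λ i → ↧ₙ (frac (x i))) (λ i → _)

  value : ∀ v → Dec (grid v ∈ Λ Δ) → ∃[ m ] NonZero m
  value v (yes _) = let m , m≢0 , _ = denoms (grid v) in m , m≢0
  value v (no  _) = 1 , _

  gridLCM : FamilyLCM (λ v → proj₁ (value v (Λ? Δ (grid v))))
  gridLCM = vecLCM (suc d) _ (λ v → proj₂ (value v (Λ? Δ (grid v))))

  l   = proj₁ gridLCM
  l≢0 = proj₁ (proj₂ gridLCM)

  module _ (x : Vector ℚ (suc d)) (x∈Λ : x ∈ Λ Δ) where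
    digit : ∀ i → ∃[ a ] frac (x i) ≡ 1/ ι (+ K) * ι (+ toℕ {K} a)
    digit i with clears x x∈Λ i
    ... | z , Kx≡z = from z Kx≡z 0≤z z<K
      where
      0≤z : 0ℤ ℤ.≤ z
      0≤z = ι-cancel-≤ (subst₂ _≤_ (ℚ.*-zeroʳ (ι (+ K))) Kx≡z
        (ℚ.*-monoˡ-≤-nonNeg (ι (+ K)) {{nn}} (frac-≥0 (x i))))
        where nn = ℚ.normalize-nonNeg K 1
      z<K : z ℤ.< + K
      z<K = ι-cancel-< (subst₂ _<_ Kx≡z (ℚ.*-identityʳ (ι (+ K)))
        (ℚ.*-monoʳ-<-pos (ι (+ K)) {{pos}} (frac-<1 (x i))))
        where pos = ℚ.normalize-pos K 1
      from : ∀ z → ι (+ K) * frac (x i) ≡ ι z → 0ℤ ℤ.≤ z → z ℤ.< + K →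
             ∃[ a ] frac (x i) ≡ 1/ ι (+ K) * ι (+ toℕ {K} a)
      from (+ a) eq _ (ℤ.+<+ a<K) = fromℕ< a<K , (begin
        frac (x i)                          ≡⟨ ℚ.*-identityˡ _ ⟨
        1ℚ * frac (x i)                     ≡⟨ cong (_* frac (x i)) (ℚ.*-inverseˡ (ι (+ K))) ⟨
        1/ ι (+ K) * ι (+ K) * frac (x i)   ≡⟨ ℚ.*-assoc (1/ ι (+ K)) (ι (+ K)) (frac (x i)) ⟩
        1/ ι (+ K) * (ι (+ K) * frac (x i)) ≡⟨ cong (1/ ι (+ K) *_) eq ⟩
        1/ ι (+ K) * ι (+ a)                ≡⟨ cong (λ b → 1/ ι (+ K) * ι (+ b)) (toℕ-fromℕ< a<K) ⟨
        1/ ι (+ K) * ι (+ toℕ (fromℕ< a<K)) ∎)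

    word : Vec (Fin K) (suc d)
    word = Vec.tabulate (proj₁ ∘ digit)

    frac-grid : ∀ i → frac (x i) ≡ frac (grid word i)
    frac-grid i = begin
      frac (x i)         ≡⟨ frac-idem (x i) ⟨
      frac (frac (x i))  ≡⟨ cong frac (proj₂ (digit i)) ⟩
      frac (1/ ι (+ K) * ι (+ toℕ (proj₁ (digit i))))
        ≡⟨ cong (λ a → frac (1/ ι (+ K) * ι (+ toℕ a))) (Vec.lookup∘tabulate (proj₁ ∘ digit) i) ⟨
      frac (grid word i) ∎

    divides-value : ∀ i (D : Dec (grid word ∈ Λ Δ)) → ↧ₙ (frac (x i)) ∣ proj₁ (value word D)
    divides-value i (yes _) = subst (λ q → ↧ₙ q ∣ _) (sym (frac-grid i))
      (proj₁ (proj₂ (proj₂ (denoms (grid word)))) i)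
    divides-value i (no ∉Λ) = contradiction (Λ-cong Δ x (grid word) frac-grid x∈Λ) ∉Λ

  common : ∀ {k} → k ∈ Denominator Δ → k ∣ l
  common (x , x∈Λ , i , refl) =
    ∣-trans (divides-value x x∈Λ i (Λ? Δ (grid (word x x∈Λ)))) (proj₁ (proj₂ (proj₂ gridLCM)) (word x x∈Λ))

  least′ : ∀ {m} → (∀ {k} → k ∈ Denominator Δ → k ∣ m) → l ∣ m
  least′ {m} h = proj₂ (proj₂ (proj₂ gridLCM)) (λ v → value∣m v (Λ? Δ (grid v)))
    where
    value∣m : ∀ v D → proj₁ (value v D) ∣ m
    value∣m v (yes ∈Λ) = proj₂ (proj₂ (proj₂ (denoms (grid v)))) (λ i → h (grid v , ∈Λ , i , refl))
    value∣m v (no  _)  = 1∣ m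

denominatorLCM : (Δ : LatticeSimplex d) → ∃[ l ] NonZero l × IsLCM (Denominator Δ) l
denominatorLCM Δ =
  lcmFromExponent Δ (proj₁ (Λ-exponent Δ)) (proj₁ (proj₂ (Λ-exponent Δ))) (proj₂ (proj₂ (Λ-exponent Δ)))

-- N_Δ; kept abstract, modulus-isLCM is its defining property.
abstract
  modulus : LatticeSimplex d → ℕ
  modulus Δ = proj₁ (denominatorLCM Δ)

  modulus-isLCM : (Δ : LatticeSimplex d) → IsLCM (Denominator Δ) (modulus Δ)
  modulus-isLCM Δ = proj₂ (proj₂ (denominatorLCM Δ))

  instance
    modulus-nonZero : {Δ : LatticeSimplex d} → NonZero (modulus Δ)
    modulus-nonZero {Δ = Δ} = proj₁ (proj₂ (denominatorLCM Δ))

-- Fin N is ℤ_N through its representatives 0, …, N - 1.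
Code : ℕ → ℕ → Set₁
Code N n = Pred (Vector (Fin N) n) 0ℓ

code : (Δ : LatticeSimplex d) → Code (modulus Δ) (suc d)
code Δ c = ∃[ x ] x ∈ Λ Δ × (∀ i → ι (+ toℕ (c i)) ≡ ι (+ modulus Δ) * frac (x i))

scale : ∀ N L .{{_ : NonZero N}} .{{_ : NonZero L}} → Fin N → Fin L
scale N L a = (L ℕ./ N ℕ.* toℕ a) mod L

infixr 6 _⊕_
_⊕_ : .{{_ : NonZero N₁}} .{{_ : NonZero N₂}} →
      Code N₁ m → Code N₂ n → Code (lcm N₁ N₂) (m ℕ.+ n)
_⊕_ {N₁} {N₂} C₁ C₂ c = ∃[ c₁ ] ∃[ c₂ ] c₁ ∈ C₁ × c₂ ∈ C₂ ×
  c ≗ map (scale N₁ L {{it}} {{L≢0}}) c₁ ++ map (scale N₂ L {{it}} {{L≢0}}) c₂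
  where
  L = lcm N₁ N₂
  L≢0 : NonZero L
  L≢0 = lcm-nonZero

infix 4 _≅ᶜ_
_≅ᶜ_ : Code N₁ m → Code N₂ n → Set
_≅ᶜ_ {N₁} {m} {N₂} {n} C D = Σ (N₁ ≡ N₂) λ N₁≡N₂ → Σ (Permutation m n) λ σ →
  ∀ c → c ∈ C ⇔ (λ j → cast N₁≡N₂ (c (σ ⟨$⟩ˡ j))) ∈ D

{-# OPTIONS --safe #-}

-- Both sides are equivalent to the existence of a bijection σ between the vertices of Δ
-- and those of Δ₁ and Δ₂ along which Λ Δ becomes Λ Δ₁ × Λ Δ₂ (Λ-SplitsAlong). For codes
-- this is a change of notation, x ↦ N {x}. For simplices, the free join has Λ equal to
-- Λ Δ₁ × Λ Δ₂, an affine unimodular map permutes vertices and preserves Λ, and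
-- conversely M ⊕ ℤ consists of the combinations of the (vᵢ , 1) with coefficients in Λ,
-- so the linear map given by a bijection of vertices preserving Λ is integral in both
-- directions.

module Submission where

open import Defs
open import Algebra.Bundles using (CommutativeRing)
import Algebra.Properties.Semiring.Sum as Sum
open import Data.Fin.Base using (Fin; zero; suc; toℕ; fromℕ<; cast; _↑ˡ_; _↑ʳ_; punchIn; punchOut)
open import Data.Fin.Permutation as Perm using (Permutation; _⟨$⟩ˡ_; _⟨$⟩ʳ_; permutation)
open import Data.Fin.Properties using (¬∀⟶∃¬; punchIn-punchOut; toℕ-fromℕ<; toℕ-injective; toℕ<n; toℕ-cast) renaming (_≟_ to _≟ᶠ_)
open import Data.Integer.Base as ℤ using (ℤ; +_; 0ℤ; 1ℤ)
import Data.Integer.Properties as ℤ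
open import Data.Nat.Base as ℕ using (ℕ; zero; suc; NonZero)
open import Data.Nat.Divisibility using (_∣_; divides; ∣-trans; ∣-antisym; ∣⇒≤)
open import Data.Nat.DivMod using (m%n<n; m<n⇒m%n≡m; m/n*n≡m; m≥n⇒m/n>0)
open import Data.Nat.LCM using (lcm; m∣lcm[m,n]; n∣lcm[m,n]; lcm-least)
import Data.Nat.Properties as ℕ
open import Data.Product.Base using (Σ; ∃-syntax; _×_; _,_; proj₁; proj₂)
open import Data.Product.Function.NonDependent.Propositional using (_×-⇔_)
open import Data.Rational.Base using (ℚ; mkℚ; 0ℚ; 1ℚ; _+_; _*_; _-_; -_; 1/_; _≤_; _<_; *<*; ↥_; ↧ₙ_; floor; toℚᵘ; Positive; NonNegative; ≢-nonZero; nonNegative) renaming (NonZero to NonZeroℚ)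
open import Data.Rational.Properties as ℚ using (_≟_; +-*-commutativeRing)
open import Data.Rational.Solver using (module +-*-Solver)
import Data.Rational.Unnormalised.Base as ℚᵘ
import Data.Rational.Unnormalised.Properties as ℚᵘ
open import Data.Sum.Base using (_⊎_; inj₁; inj₂)
open import Data.Vec.Functional using (Vector; []; _∷_; _++_; map; replicate; tail)
open import Data.Vec.Functional.Properties using (lookup-++ˡ; lookup-++ʳ)
open import Function.Base using (_∘_)
open import Function.Bundles using (_⇔_; mk⇔; Equivalence)
open import Function.Properties.Equivalence using (⇔-setoid)
open import Level using (0ℓ)
open import Relation.Binary.PropositionalEquality
import Relation.Binary.Reasoning.Setoid as SetoidReasoning
open import Relation.Nullary using (¬_; yes; no; contradiction)
open import Relation.Unary using (_∈_; _⊆_)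

open Sum (CommutativeRing.semiring +-*-commutativeRing) using (∑-comm; sum-permute)
open Equivalence using (to; from)
module ⇔-Reasoning = SetoidReasoning (⇔-setoid 0ℓ)

-- All linear algebra is done with rational row vectors `c ⊙ V` and vertices carrying a leading 1.
-- Affine independence then becomes linear independence, and membership in `Λ` becomes integrality
-- of `x ⊙ V`: the fractional parts drop out. Two obstacles shape the rest. An isomorphism of
-- polytopes only equates point sets, so the bijection of vertices has to be recovered from
-- extremality. An isomorphism of codes presupposes that the modulus of Δ is the lcm of the other
-- two, and it only sees vectors whose denominators divide that number. The equality of moduli must
-- therefore be derived from the splitting of `Λ`, and in the opposite direction each side must be
-- seen to bound the denominators by itself.

private
  variable
    d d₁ d₂ k l m n : ℕ

-- Linear combinations

infixl 7 _⊙_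
-- Row vector times matrix. A family of vectors is a matrix given by its rows, so matrices act from
-- the right and `λ i → M i ⊙ V` is the matrix product MV.
_⊙_ : Vector ℚ k → Vector (Vector ℚ n) k → Vector ℚ n
_⊙_ {k} c V j = ∑[ i < k ] (c i * V i j)

⊙-congˡ : {a b : Vector ℚ k} (V : Vector (Vector ℚ n) k) → a ≗ b → a ⊙ V ≗ b ⊙ V
⊙-congˡ V a≗b j = sum-cong-≗ (λ i → cong (_* V i j) (a≗b i))

⊙-congʳ : (c : Vector ℚ k) {V W : Vector (Vector ℚ n) k} → (∀ i → V i ≗ W i) → c ⊙ V ≗ c ⊙ W
⊙-congʳ c V≗W j = sum-cong-≗ (λ i → cong (c i *_) (V≗W i j))

⊙-distribʳ-+ : ∀ (a b : Vector ℚ k) (V : Vector (Vector ℚ n) k) j →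
  ((λ i → a i + b i) ⊙ V) j ≡ (a ⊙ V) j + (b ⊙ V) j
⊙-distribʳ-+ a b V j = trans
  (sum-cong-≗ (λ i → ℚ.*-distribʳ-+ (V i j) (a i) (b i)))
  (∑-distrib-+ (λ i → a i * V i j) (λ i → b i * V i j))

⊙-scale : ∀ t (a : Vector ℚ k) (V : Vector (Vector ℚ n) k) j →
  ((λ i → t * a i) ⊙ V) j ≡ t * (a ⊙ V) j
⊙-scale t a V j = trans
  (sum-cong-≗ (λ i → ℚ.*-assoc t (a i) (V i j)))
  (sym (*-distribˡ-sum t (λ i → a i * V i j)))

⊙-assoc : (c : Vector ℚ k) (M : Vector (Vector ℚ l) k) (V : Vector (Vector ℚ n) l) →
  c ⊙ M ⊙ V ≗ c ⊙ (λ i → M i ⊙ V)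
⊙-assoc {k} {l} c M V j = begin
  ∑[ b < l ] (∑[ a < k ] (c a * M a b) * V b j)
    ≡⟨ sum-cong-≗ (λ b → *-distribʳ-sum (V b j) (λ a → c a * M a b)) ⟩
  ∑[ b < l ] ∑[ a < k ] (c a * M a b * V b j)
    ≡⟨ ∑-comm (λ b a → c a * M a b * V b j) ⟩
  ∑[ a < k ] ∑[ b < l ] (c a * M a b * V b j)
    ≡⟨ sum-cong-≗ (λ a → trans (sum-cong-≗ (λ b → ℚ.*-assoc (c a) (M a b) (V b j)))
         (sym (*-distribˡ-sum (c a) (λ b → M a b * V b j)))) ⟩
  ∑[ a < k ] (c a * ∑[ b < l ] (M a b * V b j)) ∎
  where open ≡-Reasoning

0⊙ : (V : Vector (Vector ℚ n) k) → ∀ j → (replicate k 0ℚ ⊙ V) j ≡ 0ℚ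
0⊙ {k = k} V j = trans (sum-cong-≗ (λ i → ℚ.*-zeroˡ (V i j))) (sum-replicate-zero k)

unit : Fin n → Vector ℚ n
unit i j = ι (identity i j)

unit-refl : (i : Fin n) → unit i i ≡ 1ℚ
unit-refl zero    = refl
unit-refl (suc i) = unit-refl i

unit-off : {i j : Fin n} → i ≢ j → unit i j ≡ 0ℚ
unit-off {i = i} {j} i≢j with i ≟ᶠ j
... | yes i≡j = contradiction i≡j i≢j
... | no  _   = refl

identity-sym : (i j : Fin n) → identity i j ≡ identity j i
identity-sym zero    zero    = refl
identity-sym zero    (suc j) = refl
identity-sym (suc i) zero    = refl
identity-sym (suc i) (suc j) = identity-sym i j

unit-≥0 : (i j : Fin n) → 0ℚ ≤ unit i j
unit-≥0 i j with i ≟ᶠ j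
... | yes _ = ℚ.nonNegative⁻¹ 1ℚ
... | no  _ = ℚ.≤-refl

⊙-identityˡ : (i : Fin k) (V : Vector (Vector ℚ n) k) → unit i ⊙ V ≗ V i
⊙-identityˡ zero V j = trans (cong₂ _+_ (ℚ.*-identityˡ (V zero j)) (0⊙ (V ∘ suc) j)) (ℚ.+-identityʳ _)
⊙-identityˡ (suc i) V j = trans
  (cong₂ _+_ (ℚ.*-zeroˡ (V zero j)) (⊙-identityˡ i (V ∘ suc) j)) (ℚ.+-identityˡ _)

⊙-identityʳ : (c : Vector ℚ k) → c ⊙ unit ≗ c
⊙-identityʳ {k} c j = trans
  (sum-cong-≗ (λ i → trans (ℚ.*-comm (c i) (unit i j)) (cong (λ z → ι z * c i) (identity-sym i j))))
  -- By symmetry of the identity matrix the sum is `unit j` times `c` regarded as a matrix with one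
  -- column.
  (⊙-identityˡ j (λ i (_ : Fin 1) → c i) zero)

-- Lets a permutation of coordinates, which is how codes are compared, be absorbed into a reordering
-- of vertices.
⊙-permute : (x : Vector ℚ k) (V : Vector (Vector ℚ n) l) (σ : Permutation k l) →
  (x ∘ (σ ⟨$⟩ˡ_)) ⊙ V ≗ x ⊙ (V ∘ (σ ⟨$⟩ʳ_))
⊙-permute x V σ j = trans (sum-permute (λ i → x (σ ⟨$⟩ˡ i) * V i j) σ)
  (sum-cong-≗ (λ i → cong (λ a → x a * V (σ ⟨$⟩ʳ i) j) (Perm.inverseˡ σ)))

⊙-injective : {V : Vector (Vector ℚ n) k} → LinearlyIndependent V →
  ∀ {a b} → a ⊙ V ≗ b ⊙ V → a ≗ b
⊙-injective {V = V} ind {a} {b} aV≗bV i = begin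
  a i                  ≡⟨ solve 2 (λ a b → a := (a :+ :- con 1ℚ :* b) :+ b) refl (a i) (b i) ⟩
  (a i + - 1ℚ * b i) + b i ≡⟨ cong (_+ b i) (ind (λ i → a i + - 1ℚ * b i) diff i) ⟩
  0ℚ + b i             ≡⟨ ℚ.+-identityˡ (b i) ⟩
  b i                  ∎
  where
  open ≡-Reasoning
  open +-*-Solver
  diff : ∀ j → ((λ i → a i + - 1ℚ * b i) ⊙ V) j ≡ 0ℚ
  diff j = begin
    ((λ i → a i + - 1ℚ * b i) ⊙ V) j  ≡⟨ ⊙-distribʳ-+ a (λ i → - 1ℚ * b i) V j ⟩
    (a ⊙ V) j + ((λ i → - 1ℚ * b i) ⊙ V) j ≡⟨ cong₂ _+_ (aV≗bV j) (⊙-scale (- 1ℚ) b V j) ⟩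
    (b ⊙ V) j + - 1ℚ * (b ⊙ V) j ≡⟨ solve 1 (λ x → x :+ :- con 1ℚ :* x := con 0ℚ) refl ((b ⊙ V) j) ⟩
    0ℚ ∎

row-injective : {V : Vector (Vector ℚ n) k} → LinearlyIndependent V → ∀ {i j} → V i ≗ V j → i ≡ j
row-injective {V = V} ind {i} {j} Vi≗Vj with i ≟ᶠ j
... | yes i≡j = i≡j
... | no  i≢j = contradiction (trans (sym (unit-refl i)) (trans (units i) (unit-off (i≢j ∘ sym)))) λ ()
  where
  units : unit i ≗ unit j
  units = ⊙-injective ind λ t →
    trans (⊙-identityˡ i V t) (trans (Vi≗Vj t) (sym (⊙-identityˡ j V t)))

-- Gaussian elimination: row operations R clear column j₀ below the pivot, and the
-- induction hypothesis applies to the rows R i ⊙ V with that column deleted.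
spanning : ∀ k (V : Vector (Vector ℚ k) k) → LinearlyIndependent V → ∀ y → ∃[ c ] c ⊙ V ≗ y
spanning zero    V ind y = [] , λ ()
spanning (suc k) V ind y = coeff , coeff-spec
  where
  open ≡-Reasoning
  open +-*-Solver

  V₀≢0 : ¬ (∀ j → V zero j ≡ 0ℚ)
  V₀≢0 V₀≡0 = contradiction
    (ind (unit zero) (λ j → trans (⊙-identityˡ zero V j) (V₀≡0 j)) zero) λ ()

  pivot : ∃[ j ] V zero j ≢ 0ℚ
  pivot = ¬∀⟶∃¬ (suc k) (λ j → V zero j ≡ 0ℚ) (λ j → V zero j ≟ 0ℚ) V₀≢0

  j₀ : Fin (suc k)
  j₀ = proj₁ pivot

  p : ℚ
  p = V zero j₀

  instance
    p≢0 : NonZeroℚ p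
    p≢0 = ≢-nonZero (proj₂ pivot)

  div-mul : ∀ a → a * 1/ p * p ≡ a
  div-mul a = trans (ℚ.*-assoc a (1/ p) p) (trans (cong (a *_) (ℚ.*-inverseˡ p)) (ℚ.*-identityʳ a))

  R : Vector (Vector ℚ (suc k)) k
  R i = (- (V (suc i) j₀ * 1/ p)) ∷ unit i

  W : Vector (Vector ℚ (suc k)) k
  W i = R i ⊙ V

  W-j₀ : ∀ i → W i j₀ ≡ 0ℚ
  W-j₀ i = begin
    - (a * 1/ p) * p + (unit i ⊙ (V ∘ suc)) j₀ ≡⟨ cong₂ _+_ (sym (ℚ.neg-distribˡ-* (a * 1/ p) p)) (⊙-identityˡ i (V ∘ suc) j₀) ⟩
    - (a * 1/ p * p) + a ≡⟨ cong (λ z → - z + a) (div-mul a) ⟩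
    - a + a ≡⟨ ℚ.+-inverseˡ a ⟩
    0ℚ ∎
    where
    a : ℚ
    a = V (suc i) j₀

  ⊙W-j₀ : ∀ c → (c ⊙ W) j₀ ≡ 0ℚ
  ⊙W-j₀ c = trans (sum-cong-≗ (λ i → trans (cong (c i *_) (W-j₀ i)) (ℚ.*-zeroʳ (c i)))) (sum-replicate-zero k)

  off-pivot : ∀ {f g : Vector ℚ (suc k)} → f j₀ ≡ g j₀ → f ∘ punchIn j₀ ≗ g ∘ punchIn j₀ → f ≗ g
  off-pivot {f} {g} at-j₀ rest j with j₀ ≟ᶠ j
  ... | yes refl = at-j₀
  ... | no  j₀≢j = subst (λ j → f j ≡ g j) (punchIn-punchOut j₀≢j) (rest (punchOut j₀≢j))

  W′ : Vector (Vector ℚ k) k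
  W′ i = W i ∘ punchIn j₀

  -- Column `j₀` of `W` is zero, so a dependency `c` of `W′` is one of `W`, and `c ⊙ R` is one of
  -- `V`. The entries of `c ⊙ R` after the first are those of `c`, because `R` ends in an identity
  -- block.
  ind′ : LinearlyIndependent W′
  ind′ c c⊙W′≡0 i = trans (sym (⊙-identityʳ c i))
    (ind (c ⊙ R) (λ j → trans (⊙-assoc c R V j) (c⊙W≡0 j)) (suc i))
    where
    c⊙W≡0 : ∀ j → (c ⊙ W) j ≡ 0ℚ
    c⊙W≡0 = off-pivot (⊙W-j₀ c) c⊙W′≡0

  -- Subtracting this multiple of the pivot row makes `y` vanish in column `j₀`, as all combinations
  -- of `W` do, so deleting that column loses nothing.
  t : ℚ
  t = y j₀ * 1/ p

  y′ : Vector ℚ (suc k)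
  y′ j = y j - t * V zero j

  y′-j₀ : y′ j₀ ≡ 0ℚ
  y′-j₀ = trans (cong (λ z → y j₀ - z) (div-mul (y j₀))) (ℚ.+-inverseʳ (y j₀))

  rec : ∃[ c ] c ⊙ W′ ≗ y′ ∘ punchIn j₀
  rec = spanning k W′ ind′ (y′ ∘ punchIn j₀)

  c : Vector ℚ k
  c = proj₁ rec

  c⊙W≗y′ : c ⊙ W ≗ y′
  c⊙W≗y′ = off-pivot (trans (⊙W-j₀ c) (sym y′-j₀)) (proj₂ rec)

  coeff : Vector ℚ (suc k)
  coeff i = (c ⊙ R) i + t * unit zero i

  coeff-spec : coeff ⊙ V ≗ y
  coeff-spec j = begin
    (coeff ⊙ V) j ≡⟨ ⊙-distribʳ-+ (c ⊙ R) (λ i → t * unit zero i) V j ⟩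
    (c ⊙ R ⊙ V) j + ((λ i → t * unit zero i) ⊙ V) j
      ≡⟨ cong₂ _+_ (trans (⊙-assoc c R V j) (c⊙W≗y′ j))
                   (trans (⊙-scale t (unit zero) V j) (cong (t *_) (⊙-identityˡ zero V j))) ⟩
    y j - t * V zero j + t * V zero j
      ≡⟨ solve 2 (λ y z → y :- z :+ z := y) refl (y j) (t * V zero j) ⟩
    y j ∎

-- Nonnegative combinations

*-≥0 : ∀ {p q} → 0ℚ ≤ p → 0ℚ ≤ q → 0ℚ ≤ p * q
*-≥0 {p} {q} 0≤p 0≤q = ℚ.nonNegative⁻¹ (p * q)
  {{ℚ.nonNeg*nonNeg⇒nonNeg p {{nonNegative 0≤p}} q {{nonNegative 0≤q}}}}

sum-≥0 : (f : Vector ℚ n) → (∀ i → 0ℚ ≤ f i) → 0ℚ ≤ sum f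
sum-≥0 {zero}  f 0≤f = ℚ.≤-refl
sum-≥0 {suc n} f 0≤f = ℚ.+-mono-≤ (0≤f zero) (sum-≥0 (f ∘ suc) (0≤f ∘ suc))

≤-sum : (f : Vector ℚ n) → (∀ i → 0ℚ ≤ f i) → ∀ i → f i ≤ sum f
≤-sum f 0≤f zero = subst (_≤ sum f) (ℚ.+-identityʳ (f zero))
  (ℚ.+-monoʳ-≤ (f zero) (sum-≥0 (f ∘ suc) (0≤f ∘ suc)))
≤-sum f 0≤f (suc i) = subst (_≤ sum f) (ℚ.+-identityˡ (f (suc i)))
  (ℚ.+-mono-≤ (0≤f zero) (≤-sum (f ∘ suc) (0≤f ∘ suc) i))

-- Simplices in homogeneous coordinates

-- Coordinate zero of a combination is its total weight, so affine statements about `v` become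
-- linear ones. The 1 stands in front, whereas `lift` puts it last.
homogenise : Vector (Vector ℚ n) k → Vector (Vector ℚ (suc n)) k
homogenise v i = 1ℚ ∷ v i

-- The convex hull with weights attached to a fixed list of vertices, so that barycentric
-- coordinates are vectors of fixed length. Coordinate zero of the equation says that the weights
-- add up to 1.
simplex : Vector (Vector ℚ n) k → PointSet n
simplex v p = ∃[ c ] (∀ i → 0ℚ ≤ c i) × c ⊙ homogenise v ≗ 1ℚ ∷ p

∷-cong : ∀ {p q : Vector ℚ n} {a} → p ≗ q → a ∷ p ≗ a ∷ q
∷-cong p≗q zero    = refl
∷-cong p≗q (suc j) = p≗q j

⊙-homogenise-zero : (c : Vector ℚ k) (v : Vector (Vector ℚ n) k) → (c ⊙ homogenise v) zero ≡ sum c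
⊙-homogenise-zero c v = sum-cong-≗ (λ i → ℚ.*-identityʳ (c i))

vertex∈simplex : (v : Vector (Vector ℚ n) k) → ∀ {p} i → p ≗ v i → p ∈ simplex v
vertex∈simplex v i p≗vi = unit i , unit-≥0 i ,
  λ j → trans (⊙-identityˡ i (homogenise v) j) (∷-cong (sym ∘ p≗vi) j)

-- Barycentric coordinates compose by matrix multiplication, and products and sums of nonnegative
-- weights are nonnegative.
conv⊆simplex : (v : Vector (Vector ℚ n) k) {S : PointSet n} → S ⊆ simplex v → conv S ⊆ simplex v
conv⊆simplex v S⊆ {p} (_ , q , c , q∈S , 0≤c , ∑c≡1 , p≡) =
  c ⊙ C ,
  (λ i → sum-≥0 (λ a → c a * C a i) (λ a → *-≥0 (0≤c a) (proj₁ (proj₂ (S⊆ (q∈S a))) i))) ,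
  λ j → trans (⊙-assoc c C (homogenise v) j)
    (trans (⊙-congʳ c (λ a → proj₂ (proj₂ (S⊆ (q∈S a)))) j) (eq j))
  where
  C = λ a → proj₁ (S⊆ (q∈S a))
  eq : c ⊙ homogenise q ≗ 1ℚ ∷ p
  eq zero    = trans (⊙-homogenise-zero c q) ∑c≡1
  eq (suc j) = sym (p≡ j)

simplex⊆conv : (v : Vector (Vector ℚ n) k) {S : PointSet n} → (∀ i → v i ∈ S) → simplex v ⊆ conv S
simplex⊆conv v v∈S (c , 0≤c , eq) =
  _ , v , c , v∈S , 0≤c , trans (sym (⊙-homogenise-zero c v)) (eq zero) , λ j → sym (eq (suc j))

simplex-mono : (v : Vector (Vector ℚ n) k) (w : Vector (Vector ℚ n) l) →
  (∀ i → v i ∈ simplex w) → simplex v ⊆ simplex w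
simplex-mono v w v∈ = conv⊆simplex w {simplex w} (λ x → x) ∘ simplex⊆conv v {simplex w} v∈

-- P holds the barycentric coordinates of u i in w, and Q those of w in u, so P ⊙ Q is
-- unit i. As no cancellation is possible, Q j vanishes outside i whenever P j ≢ 0ℚ.
simplex-vertices : (u : Vector (Vector ℚ n) k) (w : Vector (Vector ℚ n) l) →
  LinearlyIndependent (homogenise u) →
  (∀ i → u i ∈ simplex w) → (∀ j → w j ∈ simplex u) → ∀ i → ∃[ j ] u i ≗ w j
simplex-vertices {k = k} {l} u w ind u∈ w∈ i = j , λ t → sym (wj≗ui (suc t))
  where
  open ≡-Reasoning
  U = homogenise u
  W = homogenise w

  P : Vector ℚ l
  P = proj₁ (u∈ i)

  Q : Vector (Vector ℚ k) l
  Q a = proj₁ (w∈ a)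

  P⊙Q : P ⊙ Q ≗ unit i
  P⊙Q = ⊙-injective ind λ t → begin
    (P ⊙ Q ⊙ U) t               ≡⟨ ⊙-assoc P Q U t ⟩
    (P ⊙ (λ a → Q a ⊙ U)) t     ≡⟨ ⊙-congʳ P (λ a → proj₂ (proj₂ (w∈ a))) t ⟩
    (P ⊙ W) t                   ≡⟨ proj₂ (proj₂ (u∈ i)) t ⟩
    U i t                       ≡⟨ ⊙-identityˡ i U t ⟨
    (unit i ⊙ U) t              ∎

  P≢0 : ¬ (∀ a → P a ≡ 0ℚ)
  P≢0 P≡0 = contradiction
    (trans (sym (proj₂ (proj₂ (u∈ i)) zero)) (trans (⊙-congˡ W P≡0 zero) (0⊙ W zero))) λ ()

  support : ∃[ a ] P a ≢ 0ℚ
  support = ¬∀⟶∃¬ l (λ a → P a ≡ 0ℚ) (λ a → P a ≟ 0ℚ) P≢0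

  j : Fin l
  j = proj₁ support

  Q-off : ∀ {b} → i ≢ b → Q j b ≡ 0ℚ
  Q-off {b} i≢b = *-cancel-zeroˡ (P j) (Q j b) (proj₂ support) (ℚ.≤-antisym
    (subst (P j * Q j b ≤_) (trans (P⊙Q b) (unit-off i≢b)) (≤-sum (λ a → P a * Q a b) nonneg j))
    (nonneg j))
    where
    nonneg : ∀ a → 0ℚ ≤ P a * Q a b
    nonneg a = *-≥0 (proj₁ (proj₂ (u∈ i)) a) (proj₁ (proj₂ (w∈ a)) b)

  Q≗ : ∀ b → Q j b ≡ Q j i * unit i b
  Q≗ b with i ≟ᶠ b
  ... | yes refl = sym (ℚ.*-identityʳ (Q j i))
  ... | no  i≢b  = trans (Q-off i≢b) (sym (ℚ.*-zeroʳ (Q j i)))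

  W≗ : ∀ t → W j t ≡ Q j i * U i t
  W≗ t = begin
    W j t                                 ≡⟨ proj₂ (proj₂ (w∈ j)) t ⟨
    (Q j ⊙ U) t                           ≡⟨ ⊙-congˡ U Q≗ t ⟩
    ((λ b → Q j i * unit i b) ⊙ U) t      ≡⟨ ⊙-scale (Q j i) (unit i) U t ⟩
    Q j i * (unit i ⊙ U) t                ≡⟨ cong (Q j i *_) (⊙-identityˡ i U t) ⟩
    Q j i * U i t                         ∎

  wj≗ui : ∀ t → W j t ≡ U i t
  wj≗ui t = trans (W≗ t) (trans (cong (_* U i t) Qji≡1) (ℚ.*-identityˡ (U i t)))
    where
    -- Both homogeneous vectors have 1 in coordinate zero, which fixes the factor of
    -- proportionality.
    Qji≡1 : Q j i ≡ 1ℚ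
    Qji≡1 = trans (sym (ℚ.*-identityʳ (Q j i))) (sym (W≗ zero))

-- Independent rows are pairwise distinct, so the two maps that choose an equal row are mutually
-- inverse.
rows-matching : (U : Vector (Vector ℚ n) k) (W : Vector (Vector ℚ n) l) →
  LinearlyIndependent U → LinearlyIndependent W →
  (∀ i → ∃[ j ] U i ≗ W j) → (∀ j → ∃[ i ] W j ≗ U i) →
  Σ (Permutation k l) λ σ → ∀ i → U i ≗ W (σ ⟨$⟩ʳ i)
rows-matching U W indU indW f g = permutation (proj₁ ∘ f) (proj₁ ∘ g)
  (λ j → row-injective {V = W} indW λ t → sym (trans (proj₂ (g j) t) (proj₂ (f (proj₁ (g j))) t)))
  (λ i → row-injective {V = U} indU λ t → sym (trans (proj₂ (f i) t) (proj₂ (g (proj₁ (f i))) t))) ,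
  (λ i → proj₂ (f i))

-- The vertices are the extreme points, so even the bare point set determines them up to order.
simplex-matching : (u : Vector (Vector ℚ n) k) (w : Vector (Vector ℚ n) l) →
  LinearlyIndependent (homogenise u) → LinearlyIndependent (homogenise w) →
  (∀ q → q ∈ simplex u ⇔ q ∈ simplex w) →
  Σ (Permutation k l) λ σ → ∀ i → u i ≗ w (σ ⟨$⟩ʳ i)
simplex-matching u w indU indW u⇔w =
  let σ , U≗Wσ = rows-matching (homogenise u) (homogenise w) indU indW
        (λ i → let j , u≗w = simplex-vertices u w indU u∈ w∈ i in j , ∷-cong u≗w)
        (λ j → let i , w≗u = simplex-vertices w u indW w∈ u∈ j in i , ∷-cong w≗u)
  in σ , λ i → U≗Wσ i ∘ suc
  where
  u∈ : ∀ i → u i ∈ simplex w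
  u∈ i = to (u⇔w (u i)) (vertex∈simplex u i λ _ → refl)
  w∈ : ∀ j → w j ∈ simplex u
  w∈ j = from (u⇔w (w j)) (vertex∈simplex w j λ _ → refl)

-- Integral vectors

Integral : Vector ℚ n → Set
Integral y = ∀ j → IsInteger (y j)

int-⊙ : {c : Vector ℚ k} {V : Vector (Vector ℚ n) k} →
  Integral c → (∀ i → Integral (V i)) → Integral (c ⊙ V)
int-⊙ {c = c} {V} c∈ℤ V∈ℤ j = int-sum (λ i → c i * V i j) (λ i → int-* (c∈ℤ i) (V∈ℤ i j))

int-unit : (i : Fin n) → Integral (unit i)
int-unit i j = identity i j , refl

int-resp : {y z : Vector ℚ n} → y ≗ z → Integral y → Integral z
int-resp y≗z y∈ℤ j = subst IsInteger (y≗z j) (y∈ℤ j)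

ι-sum : (f : Vector ℤ n) → ι (ℤΣ.sum f) ≡ sum (ι ∘ f)
ι-sum {zero}  f = refl
ι-sum {suc n} f = trans (ι-+ (f zero) (ℤΣ.sum (f ∘ suc))) (cong (_+_ (ι (f zero))) (ι-sum (f ∘ suc)))

ι-⊗ : ∀ (A : Matrix ℤ k m) (B : Matrix ℤ m n) i j →
  ι ((A ⊗ B) i j) ≡ ((λ l → ι (B l j)) ⊙ (λ l i → ι (A i l))) i
ι-⊗ A B i j = trans (ι-sum (λ l → A i l ℤ.* B l j)) (sum-cong-≗ λ l →
  trans (ι-* (A i l) (B l j)) (ℚ.*-comm (ι (A i l)) (ι (B l j))))

-- Affine unimodular maps

module _ (T : AffineUnimodular m n) where
  open AffineUnimodular T using (A; A⁻¹; inverseˡ; b)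

  private
    -- The matrix of `T` on homogeneous row vectors: the linear block is the transpose of `A`,
    -- because it acts from the right.
    H : Vector (Vector ℚ (suc n)) (suc m)
    H = (1ℚ ∷ (ι ∘ b)) ∷ λ j → 0ℚ ∷ λ i → ι (A i j)

    H∈ℤ : ∀ j → Integral (H j)
    H∈ℤ zero    zero    = 1ℤ , refl
    H∈ℤ zero    (suc i) = b i , refl
    H∈ℤ (suc j) zero    = 0ℤ , refl
    H∈ℤ (suc j) (suc i) = A i j , refl

    H-apply : ∀ p → (1ℚ ∷ p) ⊙ H ≗ 1ℚ ∷ apply T p
    H-apply p zero = cong (_+_ (1ℚ * 1ℚ))
      (trans (sum-cong-≗ (λ j → ℚ.*-zeroʳ (p j))) (sum-replicate-zero m))
    H-apply p (suc i) = begin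
      1ℚ * ι (b i) + ∑[ j < m ] (p j * ι (A i j))
        ≡⟨ cong₂ _+_ (ℚ.*-identityˡ (ι (b i))) (sum-cong-≗ (λ j → ℚ.*-comm (p j) (ι (A i j)))) ⟩
      ι (b i) + ∑[ j < m ] (ι (A i j) * p j)
        ≡⟨ ℚ.+-comm (ι (b i)) _ ⟩
      apply T p i ∎
      where open ≡-Reasoning

    A⁻¹ᵀ : Vector (Vector ℚ m) n
    A⁻¹ᵀ l i = ι (A⁻¹ i l)

    -- The same matrix for the inverse map, which sends q to A⁻¹q - A⁻¹b.
    H⁻¹ : Vector (Vector ℚ (suc m)) (suc n)
    H⁻¹ = (1ℚ ∷ λ i → - ((ι ∘ b) ⊙ A⁻¹ᵀ) i) ∷ λ l → 0ℚ ∷ A⁻¹ᵀ l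

    H⁻¹∈ℤ : ∀ j → Integral (H⁻¹ j)
    H⁻¹∈ℤ zero    zero    = 1ℤ , refl
    H⁻¹∈ℤ zero    (suc i) = int-neg (int-⊙ (λ l → b l , refl) (λ l i → A⁻¹ i l , refl) i)
    H⁻¹∈ℤ (suc l) zero    = 0ℤ , refl
    H⁻¹∈ℤ (suc l) (suc i) = A⁻¹ i l , refl

    HH⁻¹ : ∀ j → H j ⊙ H⁻¹ ≗ unit j
    HH⁻¹ zero zero = cong (_+_ (1ℚ * 1ℚ))
      (trans (sum-cong-≗ (λ l → ℚ.*-zeroʳ (ι (b l)))) (sum-replicate-zero n))
    HH⁻¹ zero (suc i) =
      solve 1 (λ s → con 1ℚ :* :- s :+ s := con 0ℚ) refl (((ι ∘ b) ⊙ A⁻¹ᵀ) i)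
      where open +-*-Solver
    HH⁻¹ (suc j) zero = cong (_+_ (0ℚ * 1ℚ))
      (trans (sum-cong-≗ (λ l → ℚ.*-zeroʳ (ι (A l j)))) (sum-replicate-zero n))
    HH⁻¹ (suc j) (suc i) = begin
      0ℚ * H⁻¹ zero (suc i) + ((λ l → ι (A l j)) ⊙ A⁻¹ᵀ) i
        ≡⟨ cong₂ _+_ (ℚ.*-zeroˡ (H⁻¹ zero (suc i))) (sym (ι-⊗ A⁻¹ A i j)) ⟩
      0ℚ + ι ((A⁻¹ ⊗ A) i j)   ≡⟨ ℚ.+-identityˡ _ ⟩
      ι ((A⁻¹ ⊗ A) i j)        ≡⟨ cong ι (trans (inverseˡ i j) (identity-sym i j)) ⟩
      unit j i ∎
      where open ≡-Reasoning

    H-cancel : ∀ y → y ⊙ H ⊙ H⁻¹ ≗ y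
    H-cancel y j = trans (⊙-assoc y H H⁻¹ j) (trans (⊙-congʳ y HH⁻¹ j) (⊙-identityʳ y j))

  module _ (v : Vector (Vector ℚ m) k) where
    private
      ⊙-image : ∀ c → c ⊙ homogenise (apply T ∘ v) ≗ c ⊙ homogenise v ⊙ H
      ⊙-image c j = sym (trans (⊙-assoc c (homogenise v) H j) (⊙-congʳ c (H-apply ∘ v) j))

      ⊙-image⁻¹ : ∀ c → c ⊙ homogenise (apply T ∘ v) ⊙ H⁻¹ ≗ c ⊙ homogenise v
      ⊙-image⁻¹ c j = trans (⊙-congˡ H⁻¹ (⊙-image c) j) (H-cancel (c ⊙ homogenise v) j)

    image-independent : LinearlyIndependent (homogenise v) → LinearlyIndependent (homogenise (apply T ∘ v))
    image-independent ind c c⊙≡0 = ind c λ j →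
      trans (sym (⊙-image⁻¹ c j)) (trans (⊙-congˡ H⁻¹ c⊙≡0 j) (0⊙ H⁻¹ j))

    -- `H` and `H⁻¹` have integer entries, so right multiplication by either preserves integrality.
    -- This is the invariance of `Λ` under unimodular maps.
    image-integral : ∀ x → Integral (x ⊙ homogenise v) ⇔ Integral (x ⊙ homogenise (apply T ∘ v))
    image-integral x = mk⇔
      (λ x∈ → int-resp (sym ∘ ⊙-image x) (int-⊙ x∈ H∈ℤ))
      (λ x∈ → int-resp (⊙-image⁻¹ x) (int-⊙ x∈ H⁻¹∈ℤ))

    image-simplex : ∀ q → q ∈ simplex (apply T ∘ v) ⇔ (∃[ p ] p ∈ simplex v × q ≗ apply T p)
    image-simplex q = mk⇔ preimage image
      where
      image : ∃[ p ] p ∈ simplex v × q ≗ apply T p → q ∈ simplex (apply T ∘ v)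
      image (p , (c , 0≤c , c⊙v) , q≗) = c , 0≤c , λ j → trans (⊙-image c j)
        (trans (⊙-congˡ H c⊙v j) (trans (H-apply p j) (∷-cong (sym ∘ q≗) j)))
      preimage : q ∈ simplex (apply T ∘ v) → ∃[ p ] p ∈ simplex v × q ≗ apply T p
      preimage (c , 0≤c , c⊙Tv) = p , (c , 0≤c , c⊙v) , λ j → trans (sym (c⊙Tv (suc j)))
        (trans (⊙-image c (suc j)) (trans (⊙-congˡ H c⊙v (suc j)) (H-apply p (suc j))))
        where
        p : Vector ℚ m
        p = tail (c ⊙ homogenise v)
        c⊙v : c ⊙ homogenise v ≗ 1ℚ ∷ p
        -- Coordinate zero is the sum of the weights, which is the same expression for `v` and for
        -- its image.
        c⊙v zero    = c⊙Tv zero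
        c⊙v (suc j) = refl

-- Change of basis

module _ (V : Vector (Vector ℚ k) k) (ind : LinearlyIndependent V) where
  -- The inverse matrix of `V`.
  coordinates : Vector (Vector ℚ k) k
  coordinates j = proj₁ (spanning k V ind (unit j))

  coordinates-spec : ∀ j → coordinates j ⊙ V ≗ unit j
  coordinates-spec j = proj₂ (spanning k V ind (unit j))

  -- A left inverse C of `V` is also a right inverse: VCV = V, and `V` cancels on the right because
  -- its rows are independent.
  coordinates-inverse : ∀ i → V i ⊙ coordinates ≗ unit i
  coordinates-inverse i = ⊙-injective ind λ t → begin
    (V i ⊙ coordinates ⊙ V) t           ≡⟨ ⊙-assoc (V i) coordinates V t ⟩
    (V i ⊙ (λ j → coordinates j ⊙ V)) t ≡⟨ ⊙-congʳ (V i) coordinates-spec t ⟩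
    (V i ⊙ unit) t                      ≡⟨ ⊙-identityʳ (V i) t ⟩
    V i t                               ≡⟨ ⊙-identityˡ i V t ⟨
    (unit i ⊙ V) t ∎
    where open ≡-Reasoning

module _ (V W : Vector (Vector ℚ k) k) (ind : LinearlyIndependent V) where
  -- The matrix V⁻¹W, which carries the rows of `V` to those of `W`.
  transition : Vector (Vector ℚ k) k
  transition j = coordinates V ind j ⊙ W

  transition-spec : ∀ i → V i ⊙ transition ≗ W i
  transition-spec i j = begin
    (V i ⊙ transition) j                ≡⟨ ⊙-assoc (V i) (coordinates V ind) W j ⟨
    (V i ⊙ coordinates V ind ⊙ W) j     ≡⟨ ⊙-congˡ W (coordinates-inverse V ind i) j ⟩
    (unit i ⊙ W) j                      ≡⟨ ⊙-identityˡ i W j ⟩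
    W i j ∎
    where open ≡-Reasoning

  -- Row j is the combination of W by the coordinates of unit j, whose combination of V is integral.
  transition-integral : (∀ x → Integral (x ⊙ V) → Integral (x ⊙ W)) → ∀ j → Integral (transition j)
  transition-integral V⇒W j = V⇒W (coordinates V ind j) (int-resp (sym ∘ coordinates-spec V ind j) (int-unit j))

transition-inverse : (V W : Vector (Vector ℚ k) k)
  (indV : LinearlyIndependent V) (indW : LinearlyIndependent W) →
  ∀ j → transition V W indV j ⊙ transition W V indW ≗ unit j
transition-inverse V W indV indW j t = begin
  (coordinates V indV j ⊙ W ⊙ transition W V indW) t
    ≡⟨ ⊙-assoc (coordinates V indV j) W (transition W V indW) t ⟩
  (coordinates V indV j ⊙ (λ i → W i ⊙ transition W V indW)) t
    ≡⟨ ⊙-congʳ (coordinates V indV j) (transition-spec W V indW) t ⟩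
  (coordinates V indV j ⊙ V) t
    ≡⟨ coordinates-spec V indV j t ⟩
  unit j t ∎
  where open ≡-Reasoning

-- Transposed, because `E` acts on rows from the right while `AffineUnimodular` acts on columns. Row
-- zero of `E` holds the translation.
linearPart : (E : Vector (Vector ℚ (suc n)) (suc n)) → (∀ j → Integral (E j)) → Matrix ℤ n n
linearPart E E∈ℤ i j = proj₁ (E∈ℤ (suc j) (suc i))

-- The zeros below the corner make `E` block triangular, so the lower right block of EF is the
-- product of the lower right blocks. Transposition reverses the order of the factors.
linearPart-inverse : (E F : Vector (Vector ℚ (suc n)) (suc n))
  (E∈ℤ : ∀ j → Integral (E j)) (F∈ℤ : ∀ j → Integral (F j)) →
  (∀ j → E (suc j) zero ≡ 0ℚ) → (∀ j → E j ⊙ F ≗ unit j) →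
  ∀ i j → (linearPart F F∈ℤ ⊗ linearPart E E∈ℤ) i j ≡ identity i j
linearPart-inverse {n} E F E∈ℤ F∈ℤ E₀ EF i j = ι-injective (begin
  ι ((linearPart F F∈ℤ ⊗ linearPart E E∈ℤ) i j)
    ≡⟨ ι-⊗ (linearPart F F∈ℤ) (linearPart E E∈ℤ) i j ⟩
  ∑[ l < n ] (ι (linearPart E E∈ℤ l j) * ι (linearPart F F∈ℤ i l))
    ≡⟨ sum-cong-≗ (λ l → cong₂ _*_ (sym (proj₂ (E∈ℤ (suc j) (suc l)))) (sym (proj₂ (F∈ℤ (suc l) (suc i))))) ⟩
  s
    ≡⟨ ℚ.+-identityˡ s ⟨
  0ℚ + s
    ≡⟨ cong (_+ s) (trans (cong (_* F zero (suc i)) (E₀ j)) (ℚ.*-zeroˡ (F zero (suc i)))) ⟨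
  (E (suc j) ⊙ F) (suc i)
    ≡⟨ EF (suc j) (suc i) ⟩
  unit j i
    ≡⟨ cong ι (identity-sym j i) ⟩
  ι (identity i j) ∎)
  where
  open ≡-Reasoning
  s : ℚ
  s = ∑[ l < n ] (E (suc j) (suc l) * F (suc l) (suc i))

simplex-unimodular : (v w : Vector (Vector ℚ n) (suc n)) →
  LinearlyIndependent (homogenise v) → LinearlyIndependent (homogenise w) →
  (∀ x → Integral (x ⊙ homogenise v) ⇔ Integral (x ⊙ homogenise w)) →
  Σ (AffineUnimodular n n) λ T → ∀ i → apply T (v i) ≗ w i
simplex-unimodular {n} v w indV indW v⇔w = T , T-spec
  where
  open ≡-Reasoning
  V = homogenise v
  W = homogenise w
  E = transition V W indV
  F = transition W V indW

  E∈ℤ : ∀ j → Integral (E j)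
  E∈ℤ = transition-integral V W indV (λ x → to (v⇔w x))

  F∈ℤ : ∀ j → Integral (F j)
  F∈ℤ = transition-integral W V indW (λ x → from (v⇔w x))

  T : AffineUnimodular n n
  T = record
    { A        = linearPart E E∈ℤ
    ; A⁻¹      = linearPart F F∈ℤ
    ; inverseˡ = linearPart-inverse E F E∈ℤ F∈ℤ
        -- Column zero of `V` and of `W` consists of ones, so column zero of `E` is that of V⁻¹V,
        -- the identity. Hence `E` describes an affine map.
        (λ j → coordinates-spec V indV (suc j) zero) (transition-inverse V W indV indW)
    ; inverseʳ = linearPart-inverse F E F∈ℤ E∈ℤ
        (λ j → coordinates-spec W indW (suc j) zero) (transition-inverse W V indW indV)
    ; b        = λ i → proj₁ (E∈ℤ zero (suc i))
    }

  T-spec : ∀ i → apply T (v i) ≗ w i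
  T-spec i l = begin
    ∑[ j < n ] (ι (linearPart E E∈ℤ l j) * v i j) + ι (proj₁ (E∈ℤ zero (suc l)))
      ≡⟨ cong₂ _+_ (sum-cong-≗ (λ j → trans (ℚ.*-comm (ι (linearPart E E∈ℤ l j)) (v i j))
           (cong (v i j *_) (sym (proj₂ (E∈ℤ (suc j) (suc l)))))))
           (trans (sym (proj₂ (E∈ℤ zero (suc l)))) (sym (ℚ.*-identityˡ (E zero (suc l))))) ⟩
    ∑[ j < n ] (v i j * E (suc j) (suc l)) + 1ℚ * E zero (suc l)
      ≡⟨ ℚ.+-comm _ (1ℚ * E zero (suc l)) ⟩
    (V i ⊙ E) (suc l)
      ≡⟨ transition-spec V W indV i (suc l) ⟩
    w i l ∎

-- The free join

↑-elim : ∀ m {n} {P : Fin (m ℕ.+ n) → Set} → (∀ i → P (i ↑ˡ n)) → (∀ j → P (m ↑ʳ j)) → ∀ t → P t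
↑-elim zero    l r t       = r t
↑-elim (suc m) l r zero    = l zero
↑-elim (suc m) l r (suc t) = ↑-elim m (l ∘ suc) r t

sum-↑ : ∀ m (f : Vector ℚ (m ℕ.+ n)) → sum f ≡ sum (f ∘ (_↑ˡ n)) + sum (f ∘ (m ↑ʳ_))
sum-↑ zero    f = sym (ℚ.+-identityˡ (sum f))
sum-↑ (suc m) f = trans (cong (_+_ (f zero)) (sum-↑ m (f ∘ suc))) (sym (ℚ.+-assoc (f zero) _ _))

module _ {m n : ℕ} where
  triple : Vector ℚ m → Vector ℚ n → ℚ → Vector ℚ (m ℕ.+ (n ℕ.+ 1))
  triple p q h = p ++ (q ++ (h ∷ []))

  fst-index : Fin m → Fin (m ℕ.+ (n ℕ.+ 1))
  fst-index i = i ↑ˡ (n ℕ.+ 1)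

  snd-index : Fin n → Fin (m ℕ.+ (n ℕ.+ 1))
  snd-index j = m ↑ʳ (j ↑ˡ 1)

  height-index : Fin (m ℕ.+ (n ℕ.+ 1))
  height-index = m ↑ʳ (n ↑ʳ zero)

  triple-elim : {P : Fin (m ℕ.+ (n ℕ.+ 1)) → Set} →
    (∀ i → P (fst-index i)) → (∀ j → P (snd-index j)) → P height-index → ∀ t → P t
  triple-elim a b c = ↑-elim m a (↑-elim n b λ where zero → c)

  module _ (p : Vector ℚ m) (q : Vector ℚ n) (h : ℚ) where
    triple-fst : ∀ i → triple p q h (fst-index i) ≡ p i
    triple-fst = lookup-++ˡ p (q ++ (h ∷ []))

    triple-snd : ∀ j → triple p q h (snd-index j) ≡ q j
    triple-snd j = trans (lookup-++ʳ p (q ++ (h ∷ [])) (j ↑ˡ 1)) (lookup-++ˡ q (h ∷ []) j)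

    triple-height : triple p q h height-index ≡ h
    triple-height = trans (lookup-++ʳ p (q ++ (h ∷ [])) (n ↑ʳ zero)) (lookup-++ʳ q (h ∷ []) zero)

  triple-cong : ∀ {p p′ q q′ h h′} → p ≗ p′ → q ≗ q′ → h ≡ h′ → triple p q h ≗ triple p′ q′ h′
  triple-cong {p} {p′} {q} {q′} {h} {h′} p≗ q≗ h≡ = triple-elim
    (λ i → trans (triple-fst p q h i) (trans (p≗ i) (sym (triple-fst p′ q′ h′ i))))
    (λ j → trans (triple-snd p q h j) (trans (q≗ j) (sym (triple-snd p′ q′ h′ j))))
    (trans (triple-height p q h) (trans h≡ (sym (triple-height p′ q′ h′))))

  triple-+ : ∀ p q h → ∀ t →
    triple p (replicate n 0ℚ) 0ℚ t + triple (replicate m 0ℚ) q h t ≡ triple p q h t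
  triple-+ p q h = triple-elim
    (λ i → trans (cong₂ _+_ (triple-fst p (replicate n 0ℚ) 0ℚ i) (triple-fst (replicate m 0ℚ) q h i))
      (trans (ℚ.+-identityʳ (p i)) (sym (triple-fst p q h i))))
    (λ j → trans (cong₂ _+_ (triple-snd p (replicate n 0ℚ) 0ℚ j) (triple-snd (replicate m 0ℚ) q h j))
      (trans (ℚ.+-identityˡ (q j)) (sym (triple-snd p q h j))))
    (trans (cong₂ _+_ (triple-height p (replicate n 0ℚ) 0ℚ) (triple-height (replicate m 0ℚ) q h))
      (trans (ℚ.+-identityˡ h) (sym (triple-height p q h))))

  -- Homogeneous coordinates of a combination of join vertices, from those of its two
  -- parts: the height is the total weight of the upper part.
  glue : Vector ℚ (suc m) → Vector ℚ (suc n) → Vector ℚ (suc (m ℕ.+ (n ℕ.+ 1)))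
  glue y z = (y zero + z zero) ∷ triple (tail y) (tail z) (z zero)

  glue-cong : ∀ {y y′ z z′} → y ≗ y′ → z ≗ z′ → glue y z ≗ glue y′ z′
  glue-cong y≗ z≗ zero    = cong₂ _+_ (y≗ zero) (z≗ zero)
  glue-cong y≗ z≗ (suc t) = triple-cong (y≗ ∘ suc) (z≗ ∘ suc) (z≗ zero) t

  glue-zero : ∀ {y z} → (∀ t → glue y z t ≡ 0ℚ) → (∀ i → y i ≡ 0ℚ) × (∀ j → z j ≡ 0ℚ)
  glue-zero {y} {z} g≡0 =
    (λ where zero    → trans (sym (ℚ.+-identityʳ (y zero))) (trans (cong (_+_ (y zero)) (sym z₀≡0)) (g≡0 zero))
             (suc i) → trans (sym (triple-fst (tail y) (tail z) (z zero) i)) (g≡0 (suc (fst-index i)))) ,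
    (λ where zero    → z₀≡0
             (suc j) → trans (sym (triple-snd (tail y) (tail z) (z zero) j)) (g≡0 (suc (snd-index j))))
    where
    z₀≡0 : z zero ≡ 0ℚ
    z₀≡0 = trans (sym (triple-height (tail y) (tail z) (z zero))) (g≡0 (suc height-index))

  -- Up to the order of the entries, `glue` only replaces the first entry of `y` by its sum with the
  -- first entry of `z`, a unimodular operation. Placing the two simplices at heights 0 and 1 makes
  -- both total weights recoverable over the integers.
  glue-integral : ∀ {y z} → Integral (glue y z) ⇔ (Integral y × Integral z)
  glue-integral {y} {z} = mk⇔ split join
    where
    open +-*-Solver
    join : Integral y × Integral z → Integral (glue y z)
    join (y∈ℤ , z∈ℤ) zero    = int-+ (y∈ℤ zero) (z∈ℤ zero)
    join (y∈ℤ , z∈ℤ) (suc t) = triple-elim {λ t → IsInteger (glue y z (suc t))}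
      (λ i → subst IsInteger (sym (triple-fst (tail y) (tail z) (z zero) i)) (y∈ℤ (suc i)))
      (λ j → subst IsInteger (sym (triple-snd (tail y) (tail z) (z zero) j)) (z∈ℤ (suc j)))
      (subst IsInteger (sym (triple-height (tail y) (tail z) (z zero))) (z∈ℤ zero))
      t
    split : Integral (glue y z) → Integral y × Integral z
    split g∈ℤ =
      (λ where zero    → subst IsInteger (solve 2 (λ y z → y :+ z :+ :- z := y) refl (y zero) (z zero))
                           (int-+ (g∈ℤ zero) (int-neg z₀∈ℤ))
               (suc i) → subst IsInteger (triple-fst (tail y) (tail z) (z zero) i) (g∈ℤ (suc (fst-index i)))) ,
      (λ where zero    → z₀∈ℤ
               (suc j) → subst IsInteger (triple-snd (tail y) (tail z) (z zero) j) (g∈ℤ (suc (snd-index j))))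
      where
      z₀∈ℤ : IsInteger (z zero)
      z₀∈ℤ = subst IsInteger (triple-height (tail y) (tail z) (z zero)) (g∈ℤ (suc height-index))

  module _ {k l : ℕ} (v : Vector (Vector ℚ m) k) (w : Vector (Vector ℚ n) l) where
    lower : Vector (Vector ℚ (m ℕ.+ (n ℕ.+ 1))) k
    lower i = triple (v i) (replicate n 0ℚ) 0ℚ

    upper : Vector (Vector ℚ (m ℕ.+ (n ℕ.+ 1))) l
    upper j = triple (replicate m 0ℚ) (w j) 1ℚ

    joinVertices : Vector (Vector ℚ (m ℕ.+ (n ℕ.+ 1))) (k ℕ.+ l)
    joinVertices = lower ++ upper

    ⊙-lower : ∀ c → c ⊙ lower ≗ triple (tail (c ⊙ homogenise v)) (replicate n 0ℚ) 0ℚ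
    ⊙-lower c = triple-elim
      (λ i → trans (sum-cong-≗ (λ a → cong (c a *_) (triple-fst (v a) (replicate n 0ℚ) 0ℚ i)))
        (sym (triple-fst _ (replicate n 0ℚ) 0ℚ i)))
      (λ j → trans (vanish (λ a → triple-snd (v a) (replicate n 0ℚ) 0ℚ j))
        (sym (triple-snd (tail (c ⊙ homogenise v)) (replicate n 0ℚ) 0ℚ j)))
      (trans (vanish (λ a → triple-height (v a) (replicate n 0ℚ) 0ℚ))
        (sym (triple-height (tail (c ⊙ homogenise v)) (replicate n 0ℚ) 0ℚ)))
      where
      vanish : ∀ {f : Vector ℚ k} → (∀ a → f a ≡ 0ℚ) → ∑[ a < k ] (c a * f a) ≡ 0ℚ
      vanish f≡0 = trans (sum-cong-≗ (λ a → trans (cong (c a *_) (f≡0 a)) (ℚ.*-zeroʳ (c a)))) (sum-replicate-zero k)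

    ⊙-upper : ∀ c → c ⊙ upper ≗ triple (replicate m 0ℚ) (tail (c ⊙ homogenise w)) ((c ⊙ homogenise w) zero)
    ⊙-upper c = triple-elim
      (λ i → trans
        (trans (sum-cong-≗ (λ a → trans (cong (c a *_) (triple-fst (replicate m 0ℚ) (w a) 1ℚ i)) (ℚ.*-zeroʳ (c a))))
               (sum-replicate-zero l))
        (sym (triple-fst (replicate m 0ℚ) (tail (c ⊙ homogenise w)) _ i)))
      (λ j → trans (sum-cong-≗ (λ a → cong (c a *_) (triple-snd (replicate m 0ℚ) (w a) 1ℚ j)))
        (sym (triple-snd (replicate m 0ℚ) (tail (c ⊙ homogenise w)) _ j)))
      (trans (sum-cong-≗ (λ a → cong (c a *_) (triple-height (replicate m 0ℚ) (w a) 1ℚ)))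
        (sym (triple-height (replicate m 0ℚ) (tail (c ⊙ homogenise w)) _)))

    -- Apart from the homogenising coordinate, lower and upper vertices have disjoint supports; in
    -- that coordinate the two total weights are added.
    ⊙-join : ∀ c → c ⊙ homogenise joinVertices ≗
      glue ((c ∘ (_↑ˡ l)) ⊙ homogenise v) ((c ∘ (k ↑ʳ_)) ⊙ homogenise w)
    ⊙-join c zero    = sum-↑ k (λ i → c i * 1ℚ)
    ⊙-join c (suc t) = begin
      (c ⊙ joinVertices) t
        ≡⟨ sum-↑ k (λ i → c i * joinVertices i t) ⟩
      ((c ∘ (_↑ˡ l)) ⊙ (joinVertices ∘ (_↑ˡ l))) t + ((c ∘ (k ↑ʳ_)) ⊙ (joinVertices ∘ (k ↑ʳ_))) t
        ≡⟨ cong₂ _+_ (⊙-congʳ (c ∘ (_↑ˡ l)) (λ i t → cong (λ f → f t) (lookup-++ˡ lower upper i)) t)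
                     (⊙-congʳ (c ∘ (k ↑ʳ_)) (λ j t → cong (λ f → f t) (lookup-++ʳ lower upper j)) t) ⟩
      ((c ∘ (_↑ˡ l)) ⊙ lower) t + ((c ∘ (k ↑ʳ_)) ⊙ upper) t
        ≡⟨ cong₂ _+_ (⊙-lower (c ∘ (_↑ˡ l)) t) (⊙-upper (c ∘ (k ↑ʳ_)) t) ⟩
      _
        ≡⟨ triple-+ _ _ _ t ⟩
      glue ((c ∘ (_↑ˡ l)) ⊙ homogenise v) ((c ∘ (k ↑ʳ_)) ⊙ homogenise w) (suc t) ∎
      where open ≡-Reasoning

    join-independent : LinearlyIndependent (homogenise v) → LinearlyIndependent (homogenise w) →
      LinearlyIndependent (homogenise joinVertices)
    join-independent indV indW c c⊙≡0 =
      ↑-elim k (indV (c ∘ (_↑ˡ l)) (proj₁ parts)) (indW (c ∘ (k ↑ʳ_)) (proj₂ parts))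
      where
      parts = glue-zero (λ t → trans (sym (⊙-join c t)) (c⊙≡0 t))

    join-integral : ∀ x → Integral (x ⊙ homogenise joinVertices) ⇔
      (Integral ((x ∘ (_↑ˡ l)) ⊙ homogenise v) × Integral ((x ∘ (k ↑ʳ_)) ⊙ homogenise w))
    join-integral x = mk⇔
      (to glue-integral ∘ int-resp (⊙-join x))
      (int-resp (sym ∘ ⊙-join x) ∘ from glue-integral)

    lower∈simplex : ∀ {p} → p ∈ simplex v → triple p (replicate n 0ℚ) 0ℚ ∈ simplex joinVertices
    lower∈simplex {p} (c , 0≤c , c⊙v) = c′ , 0≤c′ , λ t → trans (⊙-join c′ t) (trans
      (glue-cong (λ i → trans (⊙-congˡ (homogenise v) (lookup-++ˡ c (replicate l 0ℚ)) i) (c⊙v i))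
        (λ j → trans (⊙-congˡ (homogenise w) (lookup-++ʳ c (replicate l 0ℚ)) j) (0⊙ (homogenise w) j)) t)
      (eq t))
      where
      c′ : Vector ℚ (k ℕ.+ l)
      c′ = c ++ replicate l 0ℚ
      0≤c′ : ∀ i → 0ℚ ≤ c′ i
      0≤c′ = ↑-elim k (λ i → subst (0ℚ ≤_) (sym (lookup-++ˡ c (replicate l 0ℚ) i)) (0≤c i))
                      (λ j → subst (0ℚ ≤_) (sym (lookup-++ʳ c (replicate l 0ℚ) j)) ℚ.≤-refl)
      eq : glue (1ℚ ∷ p) (replicate (suc n) 0ℚ) ≗ 1ℚ ∷ triple p (replicate n 0ℚ) 0ℚ
      eq zero    = refl
      eq (suc t) = refl

    upper∈simplex : ∀ {q} → q ∈ simplex w → triple (replicate m 0ℚ) q 1ℚ ∈ simplex joinVertices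
    upper∈simplex {q} (c , 0≤c , c⊙w) = c′ , 0≤c′ , λ t → trans (⊙-join c′ t) (trans
      (glue-cong (λ i → trans (⊙-congˡ (homogenise v) (lookup-++ˡ (replicate k 0ℚ) c) i) (0⊙ (homogenise v) i))
        (λ j → trans (⊙-congˡ (homogenise w) (lookup-++ʳ (replicate k 0ℚ) c) j) (c⊙w j)) t)
      (eq t))
      where
      c′ : Vector ℚ (k ℕ.+ l)
      c′ = replicate k 0ℚ ++ c
      0≤c′ : ∀ i → 0ℚ ≤ c′ i
      0≤c′ = ↑-elim k (λ i → subst (0ℚ ≤_) (sym (lookup-++ˡ (replicate k 0ℚ) c i)) ℚ.≤-refl)
                      (λ j → subst (0ℚ ≤_) (sym (lookup-++ʳ (replicate k 0ℚ) c j)) (0≤c j))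
      eq : glue (replicate (suc m) 0ℚ) (1ℚ ∷ q) ≗ 1ℚ ∷ triple (replicate m 0ℚ) q 1ℚ
      eq zero    = refl
      eq (suc t) = refl

simplex-resp : (v : Vector (Vector ℚ n) k) {p q : Vector ℚ n} → p ≗ q → p ∈ simplex v → q ∈ simplex v
simplex-resp v p≗q (c , 0≤c , c⊙v) = c , 0≤c , λ t → trans (c⊙v t) (∷-cong p≗q t)

-- Lattice simplices and their free joins as point sets

vertices : LatticeSimplex d → Vector (Vector ℚ d) (suc d)
vertices Δ i = map ι (vertex Δ i)

vertices-independent : (Δ : LatticeSimplex d) → LinearlyIndependent (homogenise (vertices Δ))
vertices-independent Δ c c⊙≡0 = affineIndependent Δ c
  (trans (sym (⊙-homogenise-zero c (vertices Δ))) (c⊙≡0 zero)) (c⊙≡0 ∘ suc)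

points⇔simplex : (Δ : LatticeSimplex d) → ∀ p → p ∈ points Δ ⇔ p ∈ simplex (vertices Δ)
points⇔simplex {d} Δ p = mk⇔
  (conv⊆simplex (vertices Δ) {S} λ (i , p≗) → vertex∈simplex (vertices Δ) i p≗)
  (simplex⊆conv (vertices Δ) {S} (λ i → i , λ _ → refl))
  where
  S : PointSet d
  S p = ∃[ i ] p ≗ vertices Δ i

-- The free join is generated by all points of two opposite faces. The vertices are among these, and
-- each generator is already a convex combination of the vertices of its face.
freeJoin⇔simplex : (Δ₁ : LatticeSimplex d₁) (Δ₂ : LatticeSimplex d₂) →
  ∀ p → p ∈ (points Δ₁ ∘ℤ points Δ₂) ⇔ p ∈ simplex (joinVertices (vertices Δ₁) (vertices Δ₂))
freeJoin⇔simplex {d₁} {d₂} Δ₁ Δ₂ p = mk⇔ (conv⊆simplex vs {generators} generators⊆) (simplex⊆conv vs {generators} vs∈)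
  where
  v₁ = vertices Δ₁
  v₂ = vertices Δ₂
  vs = joinVertices v₁ v₂

  -- Restates the union `bottom ∪ top` local to `_∘ℤ_`, with which it agrees by computation.
  generators : PointSet (d₁ ℕ.+ (d₂ ℕ.+ 1))
  generators r = (∃[ p ] p ∈ points Δ₁ × r ≗ triple p (replicate d₂ 0ℚ) 0ℚ)
               ⊎ (∃[ q ] q ∈ points Δ₂ × r ≗ triple (replicate d₁ 0ℚ) q 1ℚ)

  generators⊆ : generators ⊆ simplex vs
  generators⊆ (inj₁ (p , p∈ , r≗)) =
    simplex-resp vs (sym ∘ r≗) (lower∈simplex v₁ v₂ (to (points⇔simplex Δ₁ p) p∈))
  generators⊆ (inj₂ (q , q∈ , r≗)) =
    simplex-resp vs (sym ∘ r≗) (upper∈simplex v₁ v₂ (to (points⇔simplex Δ₂ q) q∈))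

  vs∈ : ∀ i → vs i ∈ generators
  vs∈ = ↑-elim (suc d₁)
    (λ i → inj₁ (v₁ i , from (points⇔simplex Δ₁ (v₁ i)) (vertex∈simplex v₁ i λ _ → refl) ,
                 λ t → cong (λ f → f t) (lookup-++ˡ (lower v₁ v₂) (upper v₁ v₂) i)))
    (λ j → inj₂ (v₂ j , from (points⇔simplex Δ₂ (v₂ j)) (vertex∈simplex v₂ j λ _ → refl) ,
                 λ t → cong (λ f → f t) (lookup-++ʳ (lower v₁ v₂) (upper v₁ v₂) j)))

-- The group Λ

-- Removing the fractional parts changes `x` by its floors, and an integral combination of lattice
-- vertices is integral. This makes `Λ` a purely linear condition.
Λ⇔integral : (Δ : LatticeSimplex d) → ∀ x → x ∈ Λ Δ ⇔ Integral (x ⊙ homogenise (vertices Δ))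
Λ⇔integral {d} Δ x = mk⇔
  (λ x∈Λ → int-resp (sym ∘ split) (λ j → int-+ (unlift x∈Λ j) (floors j)))
  (λ x∈ℤ → relift (int-resp unsplit (λ j → int-+ (x∈ℤ j) (int-neg (floors j)))))
  where
  open +-*-Solver
  V = homogenise (vertices Δ)

  V∈ℤ : ∀ i → Integral (V i)
  V∈ℤ i zero    = 1ℤ , refl
  V∈ℤ i (suc j) = vertex Δ i j , refl

  floors : Integral ((ι ∘ floor ∘ x) ⊙ V)
  floors = int-⊙ (λ i → floor (x i) , refl) V∈ℤ

  split : ∀ j → (x ⊙ V) j ≡ ((frac ∘ x) ⊙ V) j + ((ι ∘ floor ∘ x) ⊙ V) j
  split j = trans
    (⊙-congˡ V (λ i → solve 2 (λ a b → a := a :- b :+ b) refl (x i) (ι (floor (x i)))) j)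
    (⊙-distribʳ-+ (frac ∘ x) (ι ∘ floor ∘ x) V j)

  unsplit : ∀ j → (x ⊙ V) j - ((ι ∘ floor ∘ x) ⊙ V) j ≡ ((frac ∘ x) ⊙ V) j
  unsplit j = trans (cong (_- ((ι ∘ floor ∘ x) ⊙ V) j) (split j))
    (solve 2 (λ a b → a :+ b :- b := a) refl (((frac ∘ x) ⊙ V) j) (((ι ∘ floor ∘ x) ⊙ V) j))

  unlift : x ∈ Λ Δ → Integral ((frac ∘ x) ⊙ V)
  unlift x∈Λ zero = subst IsInteger
    (sum-cong-≗ (λ i → cong (λ z → frac (x i) * ι z) (lookup-++ʳ (vertex Δ i) (1ℤ ∷ []) zero))) (x∈Λ (d ↑ʳ zero))
  unlift x∈Λ (suc j) = subst IsInteger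
    (sum-cong-≗ (λ i → cong (λ z → frac (x i) * ι z) (lookup-++ˡ (vertex Δ i) (1ℤ ∷ []) j))) (x∈Λ (j ↑ˡ 1))

  relift : Integral ((frac ∘ x) ⊙ V) → x ∈ Λ Δ
  relift x∈ℤ = ↑-elim d
    (λ j → subst IsInteger
      (sum-cong-≗ (λ i → cong (λ z → frac (x i) * ι z) (sym (lookup-++ˡ (vertex Δ i) (1ℤ ∷ []) j)))) (x∈ℤ (suc j)))
    (λ where zero → subst IsInteger
               (sum-cong-≗ (λ i → cong (λ z → frac (x i) * ι z) (sym (lookup-++ʳ (vertex Δ i) (1ℤ ∷ []) zero)))) (x∈ℤ zero))

Λ-Split : LatticeSimplex d₁ → LatticeSimplex d₂ → Vector ℚ (suc d₁ ℕ.+ suc d₂) → Set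
Λ-Split {d₁} {d₂} Δ₁ Δ₂ z = z ∘ (_↑ˡ suc d₂) ∈ Λ Δ₁ × z ∘ (suc d₁ ↑ʳ_) ∈ Λ Δ₂

Λ-SplitsAlong : LatticeSimplex d → LatticeSimplex d₁ → LatticeSimplex d₂ →
  Permutation (suc d) (suc d₁ ℕ.+ suc d₂) → Set
Λ-SplitsAlong Δ Δ₁ Δ₂ σ = ∀ x → x ∈ Λ Δ ⇔ Λ-Split Δ₁ Δ₂ (x ∘ (σ ⟨$⟩ˡ_))

-- The right-hand side is the `Λ` condition of the free join, its vertices reordered to match the
-- coordinates of `x`. Splitting along `σ` thus says that Δ and the reordered join have the same
-- `Λ`.
Λ-Split⇔integral : (Δ₁ : LatticeSimplex d₁) (Δ₂ : LatticeSimplex d₂) (x : Vector ℚ k)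
  (σ : Permutation k (suc d₁ ℕ.+ suc d₂)) → Λ-Split Δ₁ Δ₂ (x ∘ (σ ⟨$⟩ˡ_)) ⇔
    Integral (x ⊙ homogenise (joinVertices (vertices Δ₁) (vertices Δ₂) ∘ (σ ⟨$⟩ʳ_)))
Λ-Split⇔integral {d₁} {d₂} Δ₁ Δ₂ x σ = begin
  Λ-Split Δ₁ Δ₂ z
    ≈⟨ Λ⇔integral Δ₁ (z ∘ (_↑ˡ suc d₂)) ×-⇔ Λ⇔integral Δ₂ (z ∘ (suc d₁ ↑ʳ_)) ⟩
  (Integral ((z ∘ (_↑ˡ suc d₂)) ⊙ homogenise v₁) × Integral ((z ∘ (suc d₁ ↑ʳ_)) ⊙ homogenise v₂))
    ≈⟨ join-integral v₁ v₂ z ⟨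
  Integral (z ⊙ homogenise w)
    ≈⟨ mk⇔ (int-resp (⊙-permute x (homogenise w) σ)) (int-resp (sym ∘ ⊙-permute x (homogenise w) σ)) ⟩
  Integral (x ⊙ homogenise (w ∘ (σ ⟨$⟩ʳ_))) ∎
  where
  open ⇔-Reasoning
  v₁ = vertices Δ₁
  v₂ = vertices Δ₂
  w  = joinVertices v₁ v₂
  z  = x ∘ (σ ⟨$⟩ˡ_)

-- Free joins and splittings of Λ

module _ (Δ : LatticeSimplex d) (Δ₁ : LatticeSimplex d₁) (Δ₂ : LatticeSimplex d₂) where
  private
    v₁ = vertices Δ₁
    v₂ = vertices Δ₂
    v  = vertices Δ
    w  = joinVertices v₁ v₂

  freeJoin-vertices : ((T , _) : points Δ ≅ (points Δ₁ ∘ℤ points Δ₂)) →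
    Σ (Permutation (suc d) (suc d₁ ℕ.+ suc d₂)) λ σ → ∀ i → apply T (v i) ≗ w (σ ⟨$⟩ʳ i)
  freeJoin-vertices (T , image) = simplex-matching u w u-ind w-ind u⇔w
    where
    open ⇔-Reasoning
    u = apply T ∘ v

    u⇔w : ∀ q → q ∈ simplex u ⇔ q ∈ simplex w
    u⇔w q = begin
      q ∈ simplex u                             ≈⟨ image-simplex T v q ⟩
      (∃[ p ] p ∈ simplex v × q ≗ apply T p)
        ≈⟨ mk⇔ (λ (p , p∈ , q≗) → p , from (points⇔simplex Δ p) p∈ , q≗)
               (λ (p , p∈ , q≗) → p , to (points⇔simplex Δ p) p∈ , q≗) ⟩
      (∃[ p ] p ∈ points Δ × q ≗ apply T p)     ≈⟨ image q ⟨
      q ∈ (points Δ₁ ∘ℤ points Δ₂)              ≈⟨ freeJoin⇔simplex Δ₁ Δ₂ q ⟩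
      q ∈ simplex w                             ∎

    u-ind : LinearlyIndependent (homogenise u)
    u-ind = image-independent T v (vertices-independent Δ)

    w-ind : LinearlyIndependent (homogenise w)
    w-ind = join-independent v₁ v₂ (vertices-independent Δ₁) (vertices-independent Δ₂)

  freeJoin⇒Λ-splits : points Δ ≅ (points Δ₁ ∘ℤ points Δ₂) →
    Σ (Permutation (suc d) (suc d₁ ℕ.+ suc d₂)) (Λ-SplitsAlong Δ Δ₁ Δ₂)
  freeJoin⇒Λ-splits iso@(T , _) = go (freeJoin-vertices iso)
    where
    open ⇔-Reasoning
    go : (Σ (Permutation (suc d) (suc d₁ ℕ.+ suc d₂)) λ σ → ∀ i → apply T (v i) ≗ w (σ ⟨$⟩ʳ i)) →
         Σ (Permutation (suc d) (suc d₁ ℕ.+ suc d₂)) (Λ-SplitsAlong Δ Δ₁ Δ₂)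
    go (σ , Tv≗w) = σ , λ x → begin
      x ∈ Λ Δ                                     ≈⟨ Λ⇔integral Δ x ⟩
      Integral (x ⊙ homogenise v)                 ≈⟨ image-integral T v x ⟩
      Integral (x ⊙ homogenise (apply T ∘ v))     ≈⟨ mk⇔ (int-resp (Tv⊙ x)) (int-resp (sym ∘ Tv⊙ x)) ⟩
      Integral (x ⊙ homogenise (w ∘ (σ ⟨$⟩ʳ_)))   ≈⟨ Λ-Split⇔integral Δ₁ Δ₂ x σ ⟨
      Λ-Split Δ₁ Δ₂ (x ∘ (σ ⟨$⟩ˡ_))               ∎
      where
      Tv⊙ : ∀ x → x ⊙ homogenise (apply T ∘ v) ≗ x ⊙ homogenise (w ∘ (σ ⟨$⟩ʳ_))
      Tv⊙ x = ⊙-congʳ x (λ i → ∷-cong {a = 1ℚ} (Tv≗w i))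

Λ-splits⇒freeJoin : (Δ : LatticeSimplex d) (Δ₁ : LatticeSimplex d₁) (Δ₂ : LatticeSimplex d₂) →
  ∀ σ → Λ-SplitsAlong Δ Δ₁ Δ₂ σ → points Δ ≅ (points Δ₁ ∘ℤ points Δ₂)
Λ-splits⇒freeJoin {d} {d₁} {d₂} Δ Δ₁ Δ₂ σ splits with
  -- The bijection of vertices forces d = d₁ + (d₂ + 1), so after homogenising both vertex families
  -- are bases of the same space.
  trans (ℕ.suc-injective (Perm.↔⇒≡ σ)) (cong (d₁ ℕ.+_) (ℕ.+-comm 1 d₂))
... | refl = T , λ q → begin
    q ∈ (points Δ₁ ∘ℤ points Δ₂)              ≈⟨ freeJoin⇔simplex Δ₁ Δ₂ q ⟩
    q ∈ simplex w                             ≈⟨ mk⇔ (simplex-mono w (apply T ∘ v) w∈) (simplex-mono (apply T ∘ v) w Tv∈) ⟩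
    q ∈ simplex (apply T ∘ v)                 ≈⟨ image-simplex T v q ⟩
    (∃[ p ] p ∈ simplex v × q ≗ apply T p)
      ≈⟨ mk⇔ (λ (p , p∈ , q≗) → p , from (points⇔simplex Δ p) p∈ , q≗)
             (λ (p , p∈ , q≗) → p , to (points⇔simplex Δ p) p∈ , q≗) ⟩
    (∃[ p ] p ∈ points Δ × q ≗ apply T p)     ∎
  where
  open ⇔-Reasoning
  v = vertices Δ
  w = joinVertices (vertices Δ₁) (vertices Δ₂)
  w′ = w ∘ (σ ⟨$⟩ʳ_)

  w-ind : LinearlyIndependent (homogenise w)
  w-ind = join-independent (vertices Δ₁) (vertices Δ₂) (vertices-independent Δ₁) (vertices-independent Δ₂)

  w′-ind : LinearlyIndependent (homogenise w′)
  w′-ind c c⊙≡0 i = trans (cong c (sym (Perm.inverseˡ σ)))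
    (w-ind (c ∘ (σ ⟨$⟩ˡ_)) (λ t → trans (⊙-permute c (homogenise w) σ t) (c⊙≡0 t)) (σ ⟨$⟩ʳ i))

  unimodular : Σ (AffineUnimodular d d) λ T → ∀ i → apply T (v i) ≗ w′ i
  unimodular = simplex-unimodular v w′ (vertices-independent Δ) w′-ind λ x → begin
    Integral (x ⊙ homogenise v)     ≈⟨ Λ⇔integral Δ x ⟨
    x ∈ Λ Δ                         ≈⟨ splits x ⟩
    Λ-Split Δ₁ Δ₂ (x ∘ (σ ⟨$⟩ˡ_))   ≈⟨ Λ-Split⇔integral Δ₁ Δ₂ x σ ⟩
    Integral (x ⊙ homogenise w′)    ∎

  T = proj₁ unimodular

  Tv∈ : ∀ i → apply T (v i) ∈ simplex w
  Tv∈ i = vertex∈simplex w (σ ⟨$⟩ʳ i) (proj₂ unimodular i)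

  w∈ : ∀ j → w j ∈ simplex (apply T ∘ v)
  w∈ j = vertex∈simplex (apply T ∘ v) (σ ⟨$⟩ˡ j) λ t →
    sym (trans (proj₂ unimodular (σ ⟨$⟩ˡ j) t) (cong (λ a → w a t) (Perm.inverseʳ σ)))

-- Codes

module _ (N : ℕ) .{{_ : NonZero N}} where
  private instance
    ιN-nonZero : NonZeroℚ (ι (+ N))
    ιN-nonZero = ≢-nonZero λ ιN≡0 → ℕ.≢-nonZero⁻¹ N (ℤ.+-injective (ι-injective ιN≡0))

    ιN-positive : Positive (ι (+ N))
    ιN-positive = ℚ.normalize-pos N 1

    ιN-nonNegative : NonNegative (ι (+ N))
    ιN-nonNegative = ℚ.normalize-nonNeg N 1

  ι-cancelˡ : ∀ {p q} → ι (+ N) * p ≡ ι (+ N) * q → p ≡ q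
  ι-cancelˡ {p} {q} eq = trans (sym (invert p)) (trans (cong (1/ ι (+ N) *_) eq) (invert q))
    where
    invert : ∀ p → 1/ ι (+ N) * (ι (+ N) * p) ≡ p
    invert p = trans (sym (ℚ.*-assoc (1/ ι (+ N)) (ι (+ N)) p))
      (trans (cong (_* p) (ℚ.*-inverseˡ (ι (+ N)))) (ℚ.*-identityˡ p))

  -- The bounds 0 ≤ {q} < 1 place the integer N{q} among the representatives 0, ..., N - 1.
  digit : ∀ q → IsInteger (ι (+ N) * frac q) → ∃[ a ] ι (+ toℕ {N} a) ≡ ι (+ N) * frac q
  digit q (z , Nq≡z) = go z Nq≡z 0≤z z<N
    where
    0≤z : 0ℤ ℤ.≤ z
    0≤z = ι-cancel-≤ (subst₂ _≤_ (ℚ.*-zeroʳ (ι (+ N))) Nq≡z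
      (ℚ.*-monoˡ-≤-nonNeg (ι (+ N)) (frac-≥0 q)))
    z<N : z ℤ.< + N
    z<N = ι-cancel-< (subst₂ _<_ Nq≡z (ℚ.*-identityʳ (ι (+ N)))
      (ℚ.*-monoʳ-<-pos (ι (+ N)) (frac-<1 q)))
    go : ∀ z → ι (+ N) * frac q ≡ ι z → 0ℤ ℤ.≤ z → z ℤ.< + N →
         ∃[ a ] ι (+ toℕ {N} a) ≡ ι (+ N) * frac q
    go (+ a) eq _ (ℤ.+<+ a<N) = fromℕ< a<N , trans (cong (λ b → ι (+ b)) (toℕ-fromℕ< a<N)) (sym eq)

  -- The fraction a/N lies in [0, 1) and so is its own fractional part.
  undigit : (a : Fin N) → ∃[ q ] ι (+ toℕ a) ≡ ι (+ N) * frac q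
  undigit a = q , trans (sym Nq) (cong (ι (+ N) *_) (sym (frac-id 0≤q q<1)))
    where
    q : ℚ
    q = 1/ ι (+ N) * ι (+ toℕ a)
    Nq : ι (+ N) * q ≡ ι (+ toℕ a)
    Nq = trans (sym (ℚ.*-assoc (ι (+ N)) (1/ ι (+ N)) (ι (+ toℕ a))))
      (trans (cong (_* ι (+ toℕ a)) (ℚ.*-inverseʳ (ι (+ N)))) (ℚ.*-identityˡ _))
    0≤q : 0ℚ ≤ q
    0≤q = ℚ.*-cancelˡ-≤-pos (ι (+ N)) (subst₂ _≤_ (sym (ℚ.*-zeroʳ (ι (+ N)))) (sym Nq)
      (ℚ.nonNegative⁻¹ (ι (+ toℕ a)) {{ℚ.normalize-nonNeg (toℕ a) 1}}))
    q<1 : q < 1ℚ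
    q<1 = ℚ.*-cancelˡ-<-nonNeg (ι (+ N)) (subst₂ _<_ (sym Nq) (sym (ℚ.*-identityʳ (ι (+ N))))
      (subst₂ _<_ (sym (ι≡mkℚ (+ toℕ a))) (sym (ι≡mkℚ (+ N)))
        (*<* (subst₂ ℤ._<_ (sym (ℤ.*-identityʳ (+ toℕ a))) (sym (ℤ.*-identityʳ (+ N))) (ℤ.+<+ (toℕ<n a))))))

-- A relation rather than a function of `x`, because N{x} is integral only if the denominators
-- divide N.
Represents : ∀ {N} → Vector (Fin N) n → Vector ℚ n → Set
Represents {N = N} c x = ∀ i → ι (+ toℕ (c i)) ≡ ι (+ N) * frac (x i)

-- The element of `Λ` behind a codeword may differ from `x`, but the common word forces equal
-- fractional parts, on which alone `Λ` depends.
code⇔Λ : (Δ : LatticeSimplex d) → ∀ {c x} → Represents c x → c ∈ code Δ ⇔ x ∈ Λ Δ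
code⇔Λ Δ {c} {x} rep = mk⇔
  (λ (y , y∈Λ , rep′) → Λ-cong Δ y x (λ i → ι-cancelˡ (modulus Δ) (trans (sym (rep′ i)) (rep i))) y∈Λ)
  (λ x∈Λ → x , x∈Λ , rep)

denominator-clears : ∀ q → ι (+ ↧ₙ q) * q ≡ ι (↥ q)
denominator-clears q@(mkℚ a b-1 _) = ℚ.toℚᵘ-injective (ℚᵘ.≃-trans (ℚ.toℚᵘ-homo-* (ι (+ ↧ₙ q)) q) (begin
  toℚᵘ (ι (+ ↧ₙ q)) ℚᵘ.* toℚᵘ q  ≡⟨ cong (λ z → toℚᵘ z ℚᵘ.* toℚᵘ q) (ι≡mkℚ (+ ↧ₙ q)) ⟩
  ℚᵘ.mkℚᵘ (+ ↧ₙ q) 0 ℚᵘ.* toℚᵘ q ≈⟨ ℚᵘ.*≡* cross ⟩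
  ℚᵘ.mkℚᵘ (↥ q) 0                ≡⟨ cong toℚᵘ (ι≡mkℚ (↥ q)) ⟨
  toℚᵘ (ι (↥ q))                 ∎))
  where
  open ℚᵘ.≃-Reasoning
  -- The unnormalised product has denominator 1 times that of `q`, which computes to
  -- `suc (b-1 ℕ.+ 0)`.
  cross : (+ ↧ₙ q ℤ.* a) ℤ.* 1ℤ ≡ a ℤ.* + suc (b-1 ℕ.+ 0)
  cross = trans (ℤ.*-identityʳ (+ ↧ₙ q ℤ.* a)) (trans (ℤ.*-comm (+ ↧ₙ q) a)
    (cong (λ m → a ℤ.* + suc m) (sym (ℕ.+-identityʳ b-1))))

∣⇒integer : ∀ q {N} → ↧ₙ q ∣ N → IsInteger (ι (+ N) * q)
∣⇒integer q (divides k refl) = + k ℤ.* ↥ q , (begin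
  ι (+ (k ℕ.* ↧ₙ q)) * q         ≡⟨ cong (λ z → ι z * q) (ℤ.pos-* k (↧ₙ q)) ⟩
  ι (+ k ℤ.* + ↧ₙ q) * q         ≡⟨ cong (_* q) (ι-* (+ k) (+ ↧ₙ q)) ⟩
  ι (+ k) * ι (+ ↧ₙ q) * q       ≡⟨ ℚ.*-assoc (ι (+ k)) (ι (+ ↧ₙ q)) q ⟩
  ι (+ k) * (ι (+ ↧ₙ q) * q)     ≡⟨ cong (ι (+ k) *_) (denominator-clears q) ⟩
  ι (+ k) * ι (↥ q)              ≡⟨ ι-* (+ k) (↥ q) ⟨
  ι (+ k ℤ.* ↥ q) ∎)
  where open ≡-Reasoning

Λ-denominator : (Δ : LatticeSimplex d) → ∀ x → x ∈ Λ Δ → ∀ i → ↧ₙ (frac (x i)) ∣ modulus Δ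
Λ-denominator Δ x x∈Λ i = IsLCM.commonMultiple (modulus-isLCM Δ) (x , x∈Λ , i , refl)

Λ-integer : (Δ : LatticeSimplex d) → ∀ x → x ∈ Λ Δ → ∀ i → IsInteger (ι (+ modulus Δ) * frac (x i))
Λ-integer Δ x x∈Λ i = ∣⇒integer (frac (x i)) (Λ-denominator Δ x x∈Λ i)

word : ∀ {N} .{{_ : NonZero N}} {x : Vector ℚ n} → (∀ i → IsInteger (ι (+ N) * frac (x i))) →
  Σ (Vector (Fin N) n) λ c → Represents c x
word {N = N} {x} x∈ℤ = (λ i → proj₁ (digit N (x i) (x∈ℤ i))) , λ i → proj₂ (digit N (x i) (x∈ℤ i))

-- Since a/N = (L/N)a/L, rescaling keeps the represented fraction. The reduction modulo L never
-- wraps around, because (L/N)a < (L/N)N = L.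
scale-represents : ∀ N L .{{_ : NonZero N}} .{{_ : NonZero L}} → N ∣ L → ∀ a {q} →
  ι (+ toℕ a) ≡ ι (+ N) * q → ι (+ toℕ (scale N L a)) ≡ ι (+ L) * q
scale-represents N L N∣L a {q} eq = begin
  ι (+ toℕ (scale N L a))             ≡⟨ cong (λ m → ι (+ m)) (toℕ-fromℕ< (m%n<n (L ℕ./ N ℕ.* toℕ a) L)) ⟩
  ι (+ ((L ℕ./ N ℕ.* toℕ a) ℕ.% L))   ≡⟨ cong (λ m → ι (+ m)) (m<n⇒m%n≡m small) ⟩
  ι (+ (L ℕ./ N ℕ.* toℕ a))           ≡⟨ ι-ℕ* (L ℕ./ N) (toℕ a) ⟩
  ι (+ (L ℕ./ N)) * ι (+ toℕ a)       ≡⟨ cong (ι (+ (L ℕ./ N)) *_) eq ⟩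
  ι (+ (L ℕ./ N)) * (ι (+ N) * q)     ≡⟨ ℚ.*-assoc (ι (+ (L ℕ./ N))) (ι (+ N)) q ⟨
  ι (+ (L ℕ./ N)) * ι (+ N) * q       ≡⟨ cong (_* q) (ι-ℕ* (L ℕ./ N) N) ⟨
  ι (+ (L ℕ./ N ℕ.* N)) * q           ≡⟨ cong (λ m → ι (+ m) * q) (m/n*n≡m N∣L) ⟩
  ι (+ L) * q ∎
  where
  open ≡-Reasoning
  ι-ℕ* : ∀ a b → ι (+ (a ℕ.* b)) ≡ ι (+ a) * ι (+ b)
  ι-ℕ* a b = trans (cong ι (ℤ.pos-* a b)) (ι-* (+ a) (+ b))
  small : L ℕ./ N ℕ.* toℕ a ℕ.< L
  small = subst (L ℕ./ N ℕ.* toℕ a ℕ.<_) (m/n*n≡m N∣L)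
    (ℕ.*-monoʳ-< (L ℕ./ N) {{ℕ.>-nonZero (m≥n⇒m/n>0 (∣⇒≤ N∣L))}} (toℕ<n a))

ι-toℕ-injective : ∀ {N} {a b : Fin N} {q} → ι (+ toℕ a) ≡ q → ι (+ toℕ b) ≡ q → a ≡ b
ι-toℕ-injective a≡ b≡ = toℕ-injective (ℤ.+-injective (ι-injective (trans a≡ (sym b≡))))

-- Direct sums of codes and splittings of Λ

module _ (Δ : LatticeSimplex d) (Δ₁ : LatticeSimplex d₁) (Δ₂ : LatticeSimplex d₂) where
  private
    N  = modulus Δ
    N₁ = modulus Δ₁
    N₂ = modulus Δ₂
    L  = lcm N₁ N₂
    Split = Λ-Split Δ₁ Δ₂
    SplitsAlong = Λ-SplitsAlong Δ Δ₁ Δ₂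
    instance
      L≢0 : NonZero L
      L≢0 = lcm-nonZero {N₁} {N₂}

    N₁∣L : N₁ ∣ L
    N₁∣L = m∣lcm[m,n] N₁ N₂

    N₂∣L : N₂ ∣ L
    N₂∣L = n∣lcm[m,n] N₁ N₂

  -- Scaling to L preserves fractions, so the direct sum is the product of the two groups written
  -- over a common modulus. For `encode`, words over the smaller moduli exist because these clear
  -- the denominators of each `Λ`.
  ⊕⇔Λ-Split : ∀ {e z} → Represents e z → e ∈ (code Δ₁ ⊕ code Δ₂) ⇔ Split z
  ⊕⇔Λ-Split {e} {z} rep = mk⇔ decode encode
    where
    z₁ = z ∘ (_↑ˡ suc d₂)
    z₂ = z ∘ (suc d₁ ↑ʳ_)

    decode : e ∈ (code Δ₁ ⊕ code Δ₂) → Split z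
    decode (c₁ , c₂ , (x₁ , x₁∈Λ , rep₁) , (x₂ , x₂∈Λ , rep₂) , e≗) =
      Λ-cong Δ₁ x₁ z₁ (λ i → ι-cancelˡ L (trans (sym (scale-represents N₁ L N₁∣L (c₁ i) (rep₁ i)))
        (trans (cong (λ a → ι (+ toℕ a)) (sym (trans (e≗ (i ↑ˡ suc d₂)) (lookup-++ˡ s₁ s₂ i)))) (rep (i ↑ˡ suc d₂))))) x₁∈Λ ,
      Λ-cong Δ₂ x₂ z₂ (λ j → ι-cancelˡ L (trans (sym (scale-represents N₂ L N₂∣L (c₂ j) (rep₂ j)))
        (trans (cong (λ a → ι (+ toℕ a)) (sym (trans (e≗ (suc d₁ ↑ʳ j)) (lookup-++ʳ s₁ s₂ j)))) (rep (suc d₁ ↑ʳ j))))) x₂∈Λ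
      where
      s₁ = map (scale N₁ L) c₁
      s₂ = map (scale N₂ L) c₂

    encode : Split z → e ∈ (code Δ₁ ⊕ code Δ₂)
    encode (z₁∈Λ , z₂∈Λ) = c₁ , c₂ , (z₁ , z₁∈Λ , rep₁) , (z₂ , z₂∈Λ , rep₂) , ↑-elim (suc d₁)
      (λ i → trans (ι-toℕ-injective (rep (i ↑ˡ suc d₂)) (scale-represents N₁ L N₁∣L (c₁ i) (rep₁ i))) (sym (lookup-++ˡ s₁ s₂ i)))
      (λ j → trans (ι-toℕ-injective (rep (suc d₁ ↑ʳ j)) (scale-represents N₂ L N₂∣L (c₂ j) (rep₂ j))) (sym (lookup-++ʳ s₁ s₂ j)))
      where
      word₁ = word {N = N₁} {x = z₁} (Λ-integer Δ₁ z₁ z₁∈Λ)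
      word₂ = word {N = N₂} {x = z₂} (Λ-integer Δ₂ z₂ z₂∈Λ)
      c₁ = proj₁ word₁
      c₂ = proj₁ word₂
      rep₁ = proj₂ word₁
      rep₂ = proj₂ word₂
      s₁ = map (scale N₁ L) c₁
      s₂ = map (scale N₂ L) c₂

  Λ-Split-denominator : ∀ z → Split z → ∀ j → ↧ₙ (frac (z j)) ∣ L
  Λ-Split-denominator z (z₁∈Λ , z₂∈Λ) = ↑-elim (suc d₁)
    (λ i → ∣-trans (Λ-denominator Δ₁ (z ∘ (_↑ˡ suc d₂)) z₁∈Λ i) N₁∣L)
    (λ j → ∣-trans (Λ-denominator Δ₂ (z ∘ (suc d₁ ↑ʳ_)) z₂∈Λ j) N₂∣L)

  module _ (σ : Permutation (suc d) (suc d₁ ℕ.+ suc d₂)) where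
    permute-represents : (eq : N ≡ L) → ∀ {c x} → Represents c x →
      Represents (λ j → cast eq (c (σ ⟨$⟩ˡ j))) (x ∘ (σ ⟨$⟩ˡ_))
    permute-represents eq {c} {x} rep j = trans
      (cong (λ a → ι (+ a)) (toℕ-cast eq (c (σ ⟨$⟩ˡ j))))
      (trans (rep (σ ⟨$⟩ˡ j)) (cong (λ M → ι (+ M) * frac (x (σ ⟨$⟩ˡ j))) eq))

    -- Every denominator in `Λ Δ` comes from one of the two factors. Conversely, padding an element
    -- of one factor by zeros gives an element of the product, so its denominators occur in `Λ Δ`.
    Λ-splits⇒modulus : SplitsAlong σ → N ≡ L
    Λ-splits⇒modulus splits = ∣-antisym
      (IsLCM.least (modulus-isLCM Δ) λ (x , x∈Λ , i , k≡) →
        subst (_∣ L) (trans (cong (λ a → ↧ₙ (frac (x a))) (Perm.inverseˡ σ)) (sym k≡))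
          (Λ-Split-denominator (x ∘ (σ ⟨$⟩ˡ_)) (to (splits x) x∈Λ) (σ ⟨$⟩ʳ i)))
      (lcm-least
        (IsLCM.least (modulus-isLCM Δ₁) λ (x₁ , x₁∈Λ , i , k≡) →
          subst (_∣ N) (trans (cong (↧ₙ_ ∘ frac) (lookup-++ˡ x₁ (0s (suc d₂)) i)) (sym k≡))
            (denominators {x₁ ++ 0s (suc d₂)} (split-++ x₁ (0s (suc d₂)) x₁∈Λ (0∈Λ Δ₂)) (i ↑ˡ suc d₂)))
        (IsLCM.least (modulus-isLCM Δ₂) λ (x₂ , x₂∈Λ , j , k≡) →
          subst (_∣ N) (trans (cong (↧ₙ_ ∘ frac) (lookup-++ʳ (0s (suc d₁)) x₂ j)) (sym k≡))
            (denominators {0s (suc d₁) ++ x₂} (split-++ (0s (suc d₁)) x₂ (0∈Λ Δ₁) x₂∈Λ) (suc d₁ ↑ʳ j))))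
      where
      0s : ∀ n → Vector ℚ n
      0s n = replicate n 0ℚ

      0∈Λ : ∀ {d} (Δ : LatticeSimplex d) → 0s (suc d) ∈ Λ Δ
      0∈Λ {d} Δ = from (Λ⇔integral Δ (0s (suc d))) λ j → 0ℤ , 0⊙ (homogenise (vertices Δ)) j

      split-++ : ∀ x₁ x₂ → x₁ ∈ Λ Δ₁ → x₂ ∈ Λ Δ₂ → Split (x₁ ++ x₂)
      split-++ x₁ x₂ x₁∈Λ x₂∈Λ =
        Λ-cong Δ₁ x₁ ((x₁ ++ x₂) ∘ (_↑ˡ suc d₂)) (λ i → cong frac (sym (lookup-++ˡ x₁ x₂ i))) x₁∈Λ ,
        Λ-cong Δ₂ x₂ ((x₁ ++ x₂) ∘ (suc d₁ ↑ʳ_)) (λ j → cong frac (sym (lookup-++ʳ x₁ x₂ j))) x₂∈Λ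

      -- `splits` is applied to z ∘ σ, whose transport back agrees with `z` only pointwise.
      denominators : ∀ {z} → Split z → ∀ j → ↧ₙ (frac (z j)) ∣ N
      denominators {z} (z₁∈Λ , z₂∈Λ) j = subst (_∣ N)
        (cong (λ a → ↧ₙ (frac (z a))) (Perm.inverseʳ σ))
        (Λ-denominator Δ (z ∘ (σ ⟨$⟩ʳ_)) (from (splits (z ∘ (σ ⟨$⟩ʳ_)))
          ( Λ-cong Δ₁ (z ∘ (_↑ˡ suc d₂)) (z′ ∘ (_↑ˡ suc d₂)) (λ i → cong (frac ∘ z) (sym (Perm.inverseʳ σ))) z₁∈Λ
          , Λ-cong Δ₂ (z ∘ (suc d₁ ↑ʳ_)) (z′ ∘ (suc d₁ ↑ʳ_)) (λ i → cong (frac ∘ z) (sym (Perm.inverseʳ σ))) z₂∈Λ)) (σ ⟨$⟩ˡ j))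
        where
        z′ = λ a → z (σ ⟨$⟩ʳ (σ ⟨$⟩ˡ a))

    Λ-splits⇒code : SplitsAlong σ → code Δ ≅ᶜ (code Δ₁ ⊕ code Δ₂)
    Λ-splits⇒code splits = eq , σ , λ c →
      -- Each word is represented by the fractions c i / N, so an equivalence for all rational
      -- vectors reaches every word.
      let x   = λ i → proj₁ (undigit N (c i))
          rep = λ i → proj₂ (undigit N (c i))
      in begin
      c ∈ code Δ                                               ≈⟨ code⇔Λ Δ {c} {x} rep ⟩
      x ∈ Λ Δ                                                  ≈⟨ splits x ⟩
      Split (x ∘ (σ ⟨$⟩ˡ_))                                    ≈⟨ ⊕⇔Λ-Split {z = x ∘ (σ ⟨$⟩ˡ_)} (permute-represents eq {c} {x} rep) ⟨
      (λ j → cast eq (c (σ ⟨$⟩ˡ j))) ∈ (code Δ₁ ⊕ code Δ₂)     ∎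
      where
      open ⇔-Reasoning
      eq : N ≡ L
      eq = Λ-splits⇒modulus splits

  -- The isomorphism only speaks of vectors that N clears. Membership in either side already
  -- provides this: on the left by the definition of N, on the right because the denominators divide
  -- L = N. So the word needed for each implication comes from its own premise.
  code⇒Λ-splits : ((_ , σ , _) : code Δ ≅ᶜ (code Δ₁ ⊕ code Δ₂)) → SplitsAlong σ
  code⇒Λ-splits (eq , σ , iso) x = mk⇔
    (λ x∈Λ → to (splits (Λ-integer Δ x x∈Λ)) x∈Λ)
    (λ split → from (splits (λ i → subst₂ (λ M a → IsInteger (ι (+ M) * frac (x a))) (sym eq) (Perm.inverseˡ σ)
      (∣⇒integer (frac (x (σ ⟨$⟩ˡ (σ ⟨$⟩ʳ i)))) (Λ-Split-denominator (x ∘ (σ ⟨$⟩ˡ_)) split (σ ⟨$⟩ʳ i))))) split)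
    where
    splits : (∀ i → IsInteger (ι (+ N) * frac (x i))) → x ∈ Λ Δ ⇔ Split (x ∘ (σ ⟨$⟩ˡ_))
    splits x∈ℤ = let c , rep = word {N = N} {x = x} x∈ℤ in begin
      x ∈ Λ Δ                                                  ≈⟨ code⇔Λ Δ {c} {x} rep ⟨
      c ∈ code Δ                                               ≈⟨ iso c ⟩
      (λ j → cast eq (c (σ ⟨$⟩ˡ j))) ∈ (code Δ₁ ⊕ code Δ₂)     ≈⟨ ⊕⇔Λ-Split {z = x ∘ (σ ⟨$⟩ˡ_)} (permute-represents σ eq {c} {x} rep) ⟩
      Split (x ∘ (σ ⟨$⟩ˡ_))                                    ∎
      where open ⇔-Reasoning

lemma2p9 : {d d₁ d₂ : ℕ} (Δ : LatticeSimplex d) (Δ₁ : LatticeSimplex d₁) (Δ₂ : LatticeSimplex d₂) →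
    (points Δ ≅ (points Δ₁ ∘ℤ points Δ₂)) ⇔ (code Δ ≅ᶜ (code Δ₁ ⊕ code Δ₂))
lemma2p9 Δ Δ₁ Δ₂ = mk⇔
  (λ iso → let σ , splits = freeJoin⇒Λ-splits Δ Δ₁ Δ₂ iso in Λ-splits⇒code Δ Δ₁ Δ₂ σ splits)
  (λ iso → Λ-splits⇒freeJoin Δ Δ₁ Δ₂ (proj₁ (proj₂ iso)) (code⇒Λ-splits Δ Δ₁ Δ₂ iso))
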